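{- Let $p$ be an odd prime, $a=\prod_{i=1}^m q_i^{e_i}$ with $m\ge1$, distinct primes $q_1,\dots,q_m$ and $1\le e_i\le p-1$, let $\alpha=\sqrt[p]{a}$, $K=\mathbb{Q}(\alpha)$, with ring of integers $\mathcal{O}_K$. Let $u_i,v_i$ be as in the context. If $\mathbb{Z}[\alpha]$ is $p$-maximal and all exponents $e_i$ of the prime decomposition of $a$ which are not divisible by $p$ are congruent to each other modulo $p$, then $K$ is monogenic with $$\mathcal{O}_K=\mathbb{Z}\left[\frac{\alpha^{u_1}}{\prod_{i=1}^m q_i^{v_i}}\right].$$
   Context: The polynomial $X^p-a$ is irreducible over $\mathbb{Z}$. A subring $\mathcal{O}\subseteq\mathcal{O}_K$ is $q$-maximal ($q$ a prime) if the index $[\mathcal{O}_K:\mathcal{O}]$ is not divisible by $q$. For $1\le i\le m$, $u_i,v_i$ are the integers with $1\le u_i\le p-1$, $v_i\ge0$ and $e_iu_i-pv_i=1$. A number field $L$ of degree $n$ is monogenic if there is $\vartheta\in\mathcal{O}_L$ such that $\{1,\vartheta,\dots,\vartheta^{n-1}\}$ is a $\mathbb{Z}$-basis of $\mathcal{O}_L$. -}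

module Defs where

open import Algebra.Apartness.Bundles using (HeytingCommutativeRing; HeytingField)
open import Algebra.Bundles using (CommutativeRing; Semiring)
import Algebra.Definitions.RawSemiring as RawSemiringDefs
open import Algebra.Morphism.Structures using (module RingMorphisms)
open import Data.Fin.Base using (Fin; zero; suc; toℕ)
open import Data.Integer.Base using (ℤ; +_; 1ℤ)
open import Data.Nat.Base as ℕ using (ℕ; zero; suc; NonZero)
open import Data.Nat.Divisibility using () renaming (_∣_ to _∣ℕ_)
open import Data.Nat.Primality using (Prime; prime⇒nonZero)
open import Data.Nat.Properties using (m*n≢0; m^n≢0)
open import Data.Product.Base using (Σ-syntax; ∃-syntax; _×_)
open import Data.Product using (∃!)
open import Data.Rational.Base as ℚ using (ℚ)
open import Data.Rational.Literals using (fromℤ)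
open import Data.Vec.Functional as Vector using (Vector)
open import Function.Base using (_∘_)
open import Level using (Level; _⊔_) renaming (suc to lsuc)
open import Relation.Binary.PropositionalEquality.Core using (_≡_)
open import Relation.Nullary.Negation.Core using (¬_)
open import Relation.Unary using (Pred)

∏ : ∀ {n} → Vector ℕ n → ℕ
∏ = Vector.foldr ℕ._*_ 1

∏-prime-powers≢0 : ∀ {n} {q : Vector ℕ n} → (∀ i → Prime (q i)) →
                   (v : Vector ℕ n) → NonZero (∏ (λ i → q i ℕ.^ v i))
∏-prime-powers≢0 {zero}  q-prime v = _
∏-prime-powers≢0 {suc n} q-prime v =
  m*n≢0 _ _ {{m^n≢0 _ (v zero) {{prime⇒nonZero (q-prime zero)}}}}
            {{∏-prime-powers≢0 (q-prime ∘ suc) (v ∘ suc)}}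

-- A field of characteristic zero.  Number fields are considered as subfields
-- of such a field (of ℂ, say), given by predicates on its carrier.
record ℚ-Field (c ℓ₁ ℓ₂ : Level) : Set (lsuc (c ⊔ ℓ₁ ⊔ ℓ₂)) where
  field
    heytingField : HeytingField c ℓ₁ ℓ₂

  open HeytingField heytingField public
  open HeytingCommutativeRing heytingCommutativeRing public using (commutativeRing)
  open CommutativeRing commutativeRing public using (rawRing; semiring)

  field
    ι                  : ℚ → Carrier
    ι-isRingHomomorphism :
      RingMorphisms.IsRingHomomorphism ℚ.+-*-rawRing rawRing ι

module NumberFields {c ℓ₁ ℓ₂} (F : ℚ-Field c ℓ₁ ℓ₂) where

  open ℚ-Field F public
  open RawSemiringDefs (Semiring.rawSemiring semiring) public using (_^_; sum)

  ιℤ : ℤ → Carrier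
  ιℤ = ι ∘ fromℤ

  ιℕ : ℕ → Carrier
  ιℕ = ιℤ ∘ +_

  infixl 7 _÷_
  _÷_ : Carrier → (n : ℕ) .{{_ : NonZero n}} → Carrier
  x ÷ n = x * ι (1ℤ ℚ./ n)

  powers : Carrier → (n : ℕ) → Vector Carrier n
  powers x n i = x ^ toℕ i

  -- Linear combinations with coefficients in A (below: ℤ or ℚ) embedded in the
  -- field by φ.
  module _ {a} {A : Set a} (φ : A → Carrier) where

    combination : ∀ {n} → Vector A n → Vector Carrier n → Carrier
    combination k b = sum (λ i → φ (k i) * b i)

    polynomial : ∀ {n} → Vector A n → Carrier → Carrier
    polynomial {n} k x = combination k (powers x n)

    IsBasis : ∀ {ℓ n} → Pred Carrier ℓ → Vector Carrier n → Set (c ⊔ ℓ₁ ⊔ a ⊔ ℓ)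
    IsBasis {n = n} M b =
      (∀ i → M (b i)) ×
      (∀ x → M x → Σ[ k ∈ Vector A n ] x ≈ combination k b) ×
      (∀ (k l : Vector A n) → combination k b ≈ combination l b → ∀ i → k i ≡ l i)

  -- The subfield generated by θ: all f(θ)/g(θ) with f, g ∈ ℚ[X], g(θ) ≠ 0.
  ℚ⟨_⟩ : Carrier → Pred Carrier (ℓ₁ ⊔ ℓ₂)
  ℚ⟨ θ ⟩ x =
    ∃[ m ] ∃[ n ] Σ[ f ∈ Vector ℚ m ] Σ[ g ∈ Vector ℚ n ]
      polynomial ι g θ # 0# × x * polynomial ι g θ ≈ polynomial ι f θ

  ℤ[_] : Carrier → Pred Carrier ℓ₁
  ℤ[ θ ] x = ∃[ n ] Σ[ f ∈ Vector ℤ n ] x ≈ polynomial ιℤ f θ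

  Integral : Pred Carrier ℓ₁
  Integral x = ∃[ n ] Σ[ f ∈ Vector ℤ n ] x ^ n + polynomial ιℤ f x ≈ 0#

  𝒪 : ∀ {ℓ} → Pred Carrier ℓ → Pred Carrier (ℓ₁ ⊔ ℓ)
  𝒪 K x = K x × Integral x

  HasDegree : ∀ {ℓ} → Pred Carrier ℓ → ℕ → Set (c ⊔ ℓ₁ ⊔ ℓ)
  HasDegree K n = Σ[ b ∈ Vector Carrier n ] IsBasis ι K b

  -- n is the index of the additive subgroup H of G: r is a system of
  -- representatives for the cosets of H in G.
  HasIndex : ∀ {ℓ ℓ′} → Pred Carrier ℓ → Pred Carrier ℓ′ → ℕ → Set (c ⊔ ℓ ⊔ ℓ′)
  HasIndex G H n =
    Σ[ r ∈ Vector Carrier n ]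
      (∀ i → G (r i)) ×
      (∀ x → G x → ∃! _≡_ (λ i → H (x - r i)))

  -- For a subring O of 𝒪 K.
  Maximal : ∀ {ℓ ℓ′} → ℕ → Pred Carrier ℓ → Pred Carrier ℓ′ → Set (c ⊔ ℓ₁ ⊔ ℓ ⊔ ℓ′)
  Maximal q K O = ∃[ n ] HasIndex (𝒪 K) O n × ¬ (q ∣ℕ n)

  Monogenic : ∀ {ℓ} → Pred Carrier ℓ → Set (c ⊔ ℓ₁ ⊔ ℓ)
  Monogenic L =
    ∃[ n ] HasDegree L n ×
           (∃[ ϑ ] 𝒪 L ϑ × IsBasis ιℤ (𝒪 L) (powers ϑ n))

{-# OPTIONS --safe #-}
module Submission where

-- The exponents all agree, so a = Q^E with Q = q₁ ⋯ q_m squarefree, and β = α^u / Q^V satisfies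
-- β^p = Q and β^E = α; in particular ℤ[α] ⊆ ℤ[β] and ℚ(α) = ℚ(β).  Let y be an integer of the
-- field with ℓ y ∈ ℤ[β] for a prime ℓ ≠ p.  If ℓ ∣ Q, Eisenstein's criterion at ℓ gives
-- y ∈ ℤ[β].  If ℓ ∤ Q, the integral equation of y makes ℓ y nilpotent modulo ℓ, and ℤ[β]/ℓ is
-- reduced: an iterate L = ℓ^(p-1) ≡ 1 (mod p) of Frobenius sends Σ cᵢ βⁱ to Σ cᵢ^L Q^(si) βⁱ,
-- where L = 1 + p s.  So the index of ℤ[β] in the ring of integers is a power of p, hence
-- is 1, as ℤ[α] is p-maximal.

open import Defs
open import Algebra.Bundles using (CommutativeRing; CommutativeSemiring)
import Algebra.Morphism.Structures
import Algebra.Properties.CommutativeSemigroup as CommutativeSemigroupProperties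
import Algebra.Solver.Ring as RingSolver
open import Algebra.Solver.Ring.AlmostCommutativeRing
  using (fromCommutativeRing; _-Raw-AlmostCommutative⟶_)
open import Data.Fin.Base using (Fin; zero; suc; toℕ; fromℕ; inject₁)
open import Data.Fin.Permutation using (Permutation′; permutation)
import Data.Fin.Properties as Fin
open import Data.Integer.Base as ℤ using (ℤ; +_; 1ℤ)
open import Data.Integer.Divisibility.Signed as ℤ using (divides)
import Data.Integer.Properties as ℤ
import Data.Integer.Tactic.RingSolver as ℤ-Solver
open import Data.List.Base using (List; []; _∷_; _++_; [_]; map; upTo; cartesianProductWith)
open import Data.List.Membership.Propositional using (_∈_)
open import Data.List.Membership.Propositional.Properties
  using (∈-++⁻; ∈-map⁺; ∈-map⁻; ∈-upTo⁺; ∈-upTo⁻; ∈-cartesianProductWith⁺; ∈-cartesianProductWith⁻)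
open import Data.List.Relation.Unary.All using (All; []; _∷_)
open import Data.List.Relation.Unary.Any using (here; there)
open import Data.Maybe.Base using (Maybe; just; nothing)
open import Data.Nat.Base as ℕ using (ℕ; zero; suc; NonZero)
import Data.Nat.Divisibility as ℕ
import Data.Nat.DivMod as ℕ
open import Data.Nat.ListAction using (product)
open import Data.Nat.Primality
open import Data.Nat.Primality.Factorisation using (factorise; module PrimeFactorisation)
import Data.Nat.Properties as ℕ
import Data.Nat.Tactic.RingSolver as ℕ-Solver
open import Data.Product.Base using (_×_; _,_; ∃-syntax; Σ-syntax; proj₁; proj₂)
open import Data.Rational.Base as ℚ using (ℚ)
open import Data.Rational.Literals using (fromℤ)
import Data.Rational.Properties as ℚ
import Data.Rational.Unnormalised.Base as ℚᵘ
import Data.Rational.Unnormalised.Properties as ℚᵘ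
open import Data.Sum.Base as Sum using (_⊎_; inj₁; inj₂; [_,_]′)
open import Data.Vec.Functional as Vector using (Vector; head; tail)
open import Function.Base using (_∘_; id)
open import Function.Definitions using (Injective)
open import Level using (_⊔_)
open import Relation.Binary.PropositionalEquality as ≡ using (_≡_; _≢_)
open import Relation.Nullary.Decidable using (yes; no)
open import Relation.Nullary.Negation using (¬_; contradiction)
open import Relation.Unary using (Pred; U; _≐_)

-- The ambient field comes with an apartness only: its equality is not assumed decidable, and `α` is
-- just some element with α^p = a. Independence of 1, β, ..., β^(p-1) is therefore not read off from
-- an irreducible polynomial. It falls out of the Eisenstein computation itself, repeated as an
-- infinite descent at one prime `q₀` dividing Q. Once coordinates in ℤ[β] are unique, divisibility
-- by ℓ can be tested coordinatewise, which is what the reducedness argument consumes.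
--
-- The prime p is a genuine obstacle when p does not divide Q: (β - Q)^p ≡ Q - Q^p ≡ 0 modulo p, so
-- ℤ[β]/p is not reduced. The hypothesis on ℤ[α] fills exactly this gap. If m is the index of ℤ[α],
-- Lagrange's theorem for cosets gives m y ∈ ℤ[α] ⊆ ℤ[β], and the prime factors of m, all different
-- from p, are cancelled one at a time; the index of ℤ[β] itself is never formed.

-- Primes, binomial coefficients and products in ℕ

module Arithmetic where

  open import Data.Nat.Base hiding (zero; suc)
  open import Data.Nat.Combinatorics using (_C_; k![n∸k]!∣n!)
  open import Data.Nat.Combinatorics.Specification using (nCk≡n!/k![n-k]!)
  open import Data.Nat.Divisibility
  open import Data.Nat.Properties
  open ≡
  private module CS = CommutativeSemigroupProperties *-commutativeSemigroup

  prime⇒≢1 : ∀ {p} → Prime p → ¬ p ≡ 1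
  prime⇒≢1 p-prime = nonTrivial⇒≢1 {{prime⇒nonTrivial p-prime}}

  prime∤1 : ∀ {p} → Prime p → ¬ p ∣ 1
  prime∤1 p-prime p∣1 = prime⇒≢1 p-prime (∣1⇒≡1 p∣1)

  prime∣^ : ∀ {p m} n → Prime p → p ∣ m ^ n → p ∣ m
  prime∣^ zero    p-prime p∣1 = contradiction p∣1 (prime∤1 p-prime)
  prime∣^ {m = m} (suc n) p-prime p∣ =
    [ id , prime∣^ n p-prime ]′ (euclidsLemma m (m ^ n) p-prime p∣)

  prime∣prime : ∀ {p q} → Prime p → Prime q → p ∣ q → p ≡ q
  prime∣prime p-prime q-prime p∣q =
    [ (λ p≡1 → contradiction p≡1 (prime⇒≢1 p-prime)) , id ]′ (prime⇒irreducible q-prime p∣q)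

  prime∤! : ∀ {p n} → Prime p → n < p → ¬ p ∣ n !
  prime∤! {n = zero}  p-prime _   p∣1 = prime∤1 p-prime p∣1
  prime∤! {n = suc n} p-prime n<p p∣n! with euclidsLemma (suc n) (n !) p-prime p∣n!
  ... | inj₁ p∣1+n = >⇒∤ n<p p∣1+n
  ... | inj₂ p∣n!′ = prime∤! p-prime (<-trans (n<1+n n) n<p) p∣n!′

  -- In C(p,i) · i! (p - i)! = p! with 0 < i < p, the prime p divides the right side but neither
  -- factorial on the left.
  prime∣C : ∀ {n k} → Prime (suc n) → k < n → suc n ∣ suc n C suc k
  prime∣C {n} {k} p-prime k<n
    with euclidsLemma (p C i) (i ! * (p ∸ i) !) p-prime (subst (p ∣_) (sym C*!≡!) (m∣m*n (n !)))
    where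
    p = suc n
    i = suc k

    instance
      !≢0 : NonZero (i ! * (p ∸ i) !)
      !≢0 = i !* (p ∸ i) !≢0

    i≤p : i ≤ p
    i≤p = s≤s (<⇒≤ k<n)

    C*!≡! : (p C i) * (i ! * (p ∸ i) !) ≡ p !
    C*!≡! = trans (cong (_* (i ! * (p ∸ i) !)) (nCk≡n!/k![n-k]! i≤p)) (ℕ.m/n*n≡m (k![n∸k]!∣n! i≤p))
  ... | inj₁ p∣C = p∣C
  ... | inj₂ p∣! with euclidsLemma (suc k !) ((n ∸ k) !) p-prime p∣!
  ...   | inj₁ p∣k! = contradiction p∣k! (prime∤! p-prime (s≤s k<n))
  ...   | inj₂ p∣[n-k]! = contradiction p∣[n-k]! (prime∤! p-prime (s≤s (m∸n≤m n k)))

  ^-distrib-* : ∀ m n d → (m * n) ^ d ≡ m ^ d * n ^ d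
  ^-distrib-* m n zero    = refl
  ^-distrib-* m n (suc d) =
    trans (cong (m * n *_) (^-distrib-* m n d)) (CS.interchange m n (m ^ d) (n ^ d))

  ∏-^ : ∀ {n} (q : Vector ℕ n) d → ∏ (λ i → q i ^ d) ≡ ∏ q ^ d
  ∏-^ {zero}  q d = sym (^-zeroˡ d)
  ∏-^ {suc n} q d = trans (cong (q zero ^ d *_) (∏-^ (q ∘ suc) d)) (sym (^-distrib-* (q zero) (∏ (q ∘ suc)) d))

  ∏-cong : ∀ {n} {f g : Vector ℕ n} → (∀ i → f i ≡ g i) → ∏ f ≡ ∏ g
  ∏-cong {zero}  f≗g = refl
  ∏-cong {suc n} f≗g = cong₂ _*_ (f≗g zero) (∏-cong (f≗g ∘ suc))

  prime∣∏ : ∀ {n ℓ} {q : Vector ℕ n} → Prime ℓ → (∀ i → Prime (q i)) → ℓ ∣ ∏ q → ∃[ i ] ℓ ≡ q i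
  prime∣∏ {zero}  ℓ-prime q-prime ℓ∣1 = contradiction ℓ∣1 (prime∤1 ℓ-prime)
  prime∣∏ {suc n} {q = q} ℓ-prime q-prime ℓ∣ with euclidsLemma (q zero) _ ℓ-prime ℓ∣
  ... | inj₁ ℓ∣q₀ = zero , prime∣prime ℓ-prime (q-prime zero) ℓ∣q₀
  ... | inj₂ ℓ∣∏  = let i , eq = prime∣∏ ℓ-prime (q-prime ∘ suc) ℓ∣∏ in suc i , eq

  -- Exact divisibility. The cofactor is part of the data because Eisenstein's argument computes
  -- with Q′ = Q / q.
  _∥_ : ℕ → ℕ → Set
  q ∥ n = ∃[ c ] n ≡ q * c × ¬ q ∣ c

  prime∥∏ : ∀ {n} {q : Vector ℕ n} → (∀ i → Prime (q i)) → Injective _≡_ _≡_ q → ∀ i → q i ∥ ∏ q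
  prime∥∏ {q = q} q-prime q-inj zero = ∏ (q ∘ suc) , refl , λ q₀∣∏ →
    let _ , q₀≡ = prime∣∏ (q-prime zero) (q-prime ∘ suc) q₀∣∏ in contradiction (q-inj q₀≡) λ ()
  prime∥∏ {q = q} q-prime q-inj (suc i) =
    let c , ∏≡ , ∤c = prime∥∏ (q-prime ∘ suc) (Fin.suc-injective ∘ q-inj) i in
    q zero * c , trans (cong (q zero *_) ∏≡) (CS.x∙yz≈y∙xz (q zero) (q (suc i)) c) , λ ∣q₀c →
      [ (λ ∣q₀ → contradiction (q-inj (prime∣prime (q-prime (suc i)) (q-prime zero) ∣q₀)) λ ()) , ∤c ]′
      (euclidsLemma (q zero) c (q-prime (suc i)) ∣q₀c)

  -- A multiple of p below p is 0. This turns congruent exponents in the range 1, ..., p - 1 into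
  -- equal ones.
  ∣diff∣<⇒≡ : ∀ {p m n} → m < p → n < p → p ∣ ∣ m - n ∣ → m ≡ n
  ∣diff∣<⇒≡ {p} {m} {n} m<p n<p p∣ with ∣ m - n ∣ in eq
  ... | zero  = ∣m-n∣≡0⇒m≡n eq
  ... | suc d = contradiction p∣ (>⇒∤ (subst (_< p) eq
                  (<-≤-trans (s≤s (∣m-n∣≤m⊔n m n)) (⊔-lub m<p n<p))))

  ∣difference : ∀ p {a b v w} → a ≡ 1 + p * v → b ≡ 1 + p * w → p ∣ ∣ a - b ∣
  ∣difference p {v = v} {w} refl refl =
    divides ∣ v - w ∣ (trans (sym (*-distribˡ-∣-∣ p v w)) (*-comm p _))

-- The Frobenius identity modulo a prime, in a commutative semiring

module Frobenius {c ℓ} (S : CommutativeSemiring c ℓ) where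

  open import Data.Nat.Combinatorics using (_C_; nCn≡1)
  open CommutativeSemiring S hiding (zero)

  -- The error term of Frobenius must stay in ℤ[β], which is only a predicate on the field; hence a
  -- closed predicate `P` is carried along. Semirings suffice, so that ℕ is covered too.
  module Closed {ℓ′} (P : Pred Carrier ℓ′)
    (P-0 : P 0#)
    (P-1 : P 1#)
    (P-+ : ∀ {x y} → P x → P y → P (x + y))
    (P-* : ∀ {x y} → P x → P y → P (x * y))
    where

    open import Algebra.Properties.Semiring.Exp semiring using (_^_)
    open import Algebra.Properties.Semiring.Mult semiring
      using (×-assocˡ; ×-homo-1; ×-congˡ) renaming (_×_ to _·_)
    open import Algebra.Properties.CommutativeMonoid.Mult +-commutativeMonoid using (×-distrib-+)
    open import Algebra.Properties.CommutativeMonoid.Sum +-commutativeMonoid using (sum; sum-init-last)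
    open import Relation.Binary.Reasoning.Setoid setoid

    P-× : ∀ n {x} → P x → P (n · x)
    P-× zero    Px = P-0
    P-× (suc n) Px = P-+ Px (P-× n Px)

    P-^ : ∀ n {x} → P x → P (x ^ n)
    P-^ zero    Px = P-1
    P-^ (suc n) Px = P-* Px (P-^ n Px)

    sum-multiple : ∀ {n} p (f : Vector Carrier n) → (∀ i → ∃[ w ] P w × f i ≈ p · w) →
                   ∃[ w ] P w × sum f ≈ p · w
    sum-multiple {zero}  p f f-mult = 0# , P-0 , sym (×-zeroʳ p)
      where
      ×-zeroʳ : ∀ n → n · 0# ≈ 0#
      ×-zeroʳ zero    = refl
      ×-zeroʳ (suc n) = trans (+-identityˡ _) (×-zeroʳ n)
    sum-multiple {suc n} p f f-mult =
      let w , Pw , f0≈ = f-mult zero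
          w′ , Pw′ , ∑f≈ = sum-multiple p (f ∘ suc) (f-mult ∘ suc)
      in w + w′ , P-+ Pw Pw′ , trans (+-cong f0≈ ∑f≈) (sym (×-distrib-+ w w′ p))

    -- All terms of the binomial expansion except the two outer ones carry a coefficient C(p,i) with
    -- 0 < i < p, a multiple of p.
    frobenius : ∀ {p x y} → Prime p → P x → P y →
                ∃[ w ] P w × (x + y) ^ p ≈ (x ^ p + y ^ p) + p · w
    frobenius {zero} 0-prime = contradiction 0-prime ¬prime[0]
    frobenius {p@(suc n)} {x} {y} p-prime Px Py = w , Pw , (begin
      (x + y) ^ p                          ≈⟨ theorem p x y ⟩
      t zero + sum (t ∘ suc)                ≈⟨ +-cong first (sum-init-last (t ∘ suc)) ⟩
      y ^ p + (sum middle + t (suc (fromℕ n))) ≈⟨ +-congˡ (+-cong ∑≈ last) ⟩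
      y ^ p + (p · w + x ^ p)             ≈⟨ +-congˡ (+-comm _ _) ⟩
      y ^ p + (x ^ p + p · w)             ≈⟨ +-assoc _ _ _ ⟨
      (y ^ p + x ^ p) + p · w             ≈⟨ +-congʳ (+-comm _ _) ⟩
      (x ^ p + y ^ p) + p · w             ∎)
      where
      open import Algebra.Properties.CommutativeSemiring.Binomial S using (theorem)
      open import Algebra.Properties.Semiring.Binomial semiring x y using (binomial; binomialTerm)

      t : Vector Carrier (suc p)
      t = binomialTerm p

      middle : Vector Carrier n
      middle i = t (suc (inject₁ i))

      first : t zero ≈ y ^ p
      first = trans (×-homo-1 _) (*-identityˡ _)

      last : t (suc (fromℕ n)) ≈ x ^ p
      last = begin
        t (suc (fromℕ n))          ≡⟨ ≡.cong (λ m → (p C suc m) · (x ^ suc m * y ^ (n ℕ.∸ m))) (Fin.toℕ-fromℕ n) ⟩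
        (p C p) · (x ^ p * y ^ (n ℕ.∸ n)) ≡⟨ ≡.cong₂ (λ b m → b · (x ^ p * y ^ m)) (nCn≡1 p) (ℕ.n∸n≡0 n) ⟩
        1 · (x ^ p * 1#)          ≈⟨ trans (×-homo-1 _) (*-identityʳ _) ⟩
        x ^ p                     ∎

      middle-multiple : ∀ i → ∃[ w ] P w × middle i ≈ p · w
      middle-multiple i with Arithmetic.prime∣C p-prime (≡.subst (ℕ._< n) (≡.sym (Fin.toℕ-inject₁ i)) (Fin.toℕ<n i))
      ... | ℕ.divides c C≡c*p =
        c · b , P-× c (P-* (P-^ (toℕ j) Px) (P-^ (p ℕ.∸ toℕ j) Py)) ,
        trans (×-congˡ (≡.trans C≡c*p (ℕ.*-comm c p))) (sym (×-assocˡ b p c))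
        where
        j = suc (inject₁ i)
        b = binomial p j

      multiple = sum-multiple p middle middle-multiple
      w = proj₁ multiple
      Pw = proj₁ (proj₂ multiple)
      ∑≈ = proj₂ (proj₂ multiple)

-- Fermat's little theorem without subtraction

module Fermat where

  open import Data.Nat.Base hiding (zero; suc)
  open import Data.Nat.Divisibility
  open import Data.Nat.Properties
  open ≡

  -- Induction on n: the Frobenius identity for 1 + n in ℕ, with the trivial predicate `U`.
  fermat : ∀ {p} → Prime p → ∀ n → ∃[ w ] n ^ p ≡ n + p * w
  fermat {suc p} p-prime zero    = 0 , sym (*-zeroʳ p)
  fermat {p} p-prime (suc n) =
    let w , _ , eq = frobenius {x = 1} {n} p-prime _ _
        v , eq′ = fermat p-prime n
    in v + w , (begin
      suc n ^ p                       ≡⟨ ^≡^′ (suc n) p ⟩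
      suc n ^′ p                      ≡⟨ eq ⟩
      (1 ^′ p + n ^′ p) + p · w       ≡⟨ cong₂ _+_ (cong₂ _+_ (trans (sym (^≡^′ 1 p)) (^-zeroˡ p)) (trans (sym (^≡^′ n p)) eq′)) (·≡* p w) ⟩
      (1 + (n + p * v)) + p * w       ≡⟨ regroup n p v w ⟩
      suc n + p * (v + w)             ∎)
    where
    open ≡-Reasoning
    open Frobenius.Closed +-*-commutativeSemiring U _ _ _ _
    open import Algebra.Properties.Semiring.Exp +-*-semiring using () renaming (_^_ to _^′_)
    open import Algebra.Properties.Semiring.Mult +-*-semiring using () renaming (_×_ to _·_)

    ^≡^′ : ∀ m k → m ^ k ≡ m ^′ k
    ^≡^′ m zero    = refl
    ^≡^′ m (suc k) = cong (m *_) (^≡^′ m k)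

    ·≡* : ∀ k m → k · m ≡ k * m
    ·≡* zero    m = refl
    ·≡* (suc k) m = cong (λ t → m + t) (·≡* k m)

    regroup : ∀ n p v w → (1 + (n + p * v)) + p * w ≡ suc n + p * (v + w)
    regroup = ℕ-Solver.solve-∀

  -- Being nonzero, `M` is 1 + k for some k; then m k = p w, and p, which does not divide m, divides
  -- k.
  cancel-multiplier : ∀ {p m w} M → .{{NonZero M}} → Prime p → ¬ p ∣ m → m * M ≡ m + p * w →
                      ∃[ s ] M ≡ 1 + p * s
  cancel-multiplier {p} {m} {w} (suc k) p-prime p∤m m*M≡ =
    [ (λ p∣m → contradiction p∣m p∤m) , (λ (divides s k≡s*p) → s , cong suc (trans k≡s*p (*-comm s p))) ]′
    (euclidsLemma m k p-prime (divides w
      (trans (+-cancelˡ-≡ m _ _ (trans (sym (*-suc m k)) m*M≡)) (*-comm p w))))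

  fermat-unit : ∀ {p m} → Prime p → ¬ p ∣ m → ∃[ s ] m ^ (p ∸ 1) ≡ 1 + p * s
  fermat-unit {zero} 0-prime = contradiction 0-prime ¬prime[0]
  fermat-unit {suc n} {m} p-prime p∤m =
    cancel-multiplier (m ^ n) {{m^n≢0 m n {{≢-nonZero m≢0}}}} p-prime p∤m (proj₂ (fermat p-prime m))
    where
    m≢0 : m ≢ 0
    m≢0 refl = p∤m (suc n ∣0)

-- The embedding of ℤ into ℚ

module FromInteger where

  fromℤ-+ : ∀ a b → fromℤ (a ℤ.+ b) ≡ fromℤ a ℚ.+ fromℤ b
  fromℤ-+ a b = ℚ.toℚᵘ-injective (ℚᵘ.≃-sym (ℚᵘ.≃-trans (ℚ.toℚᵘ-homo-+ (fromℤ a) (fromℤ b)) (ℚᵘ.*≡* (lemma a b))))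
    where
    lemma : ∀ a b → (a ℤ.* 1ℤ ℤ.+ b ℤ.* 1ℤ) ℤ.* 1ℤ ≡ (a ℤ.+ b) ℤ.* 1ℤ
    lemma = ℤ-Solver.solve-∀

  fromℤ-* : ∀ a b → fromℤ (a ℤ.* b) ≡ fromℤ a ℚ.* fromℤ b
  fromℤ-* a b = ℚ.toℚᵘ-injective (ℚᵘ.≃-sym (ℚᵘ.≃-trans (ℚ.toℚᵘ-homo-* (fromℤ a) (fromℤ b)) (ℚᵘ.*≡* ≡.refl)))

  fromℤ-neg : ∀ a → fromℤ (ℤ.- a) ≡ ℚ.- fromℤ a
  fromℤ-neg (+ zero)    = ≡.refl
  fromℤ-neg (ℤ.+[1+ n ]) = ≡.refl
  fromℤ-neg (ℤ.-[1+ n ]) = ≡.refl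

  fromℤ*1/ : ∀ n .{{_ : NonZero n}} → fromℤ (+ n) ℚ.* (1ℤ ℚ./ n) ≡ ℚ.1ℚ
  fromℤ*1/ n@(suc m) = ℚ.toℚᵘ-injective (ℚᵘ.≃-trans (ℚ.toℚᵘ-homo-* (fromℤ (+ n)) (1ℤ ℚ./ n))
    (ℚᵘ.≃-trans (ℚᵘ.*-congˡ {ℚᵘ.mkℚᵘ (+ n) 0} (ℚ.toℚᵘ-fromℚᵘ (ℚᵘ.mkℚᵘ 1ℤ m)))
      (ℚᵘ.*≡* (≡.trans (lemma (+ n)) (≡.cong (λ d → 1ℤ ℤ.* (+ suc d)) (≡.sym (ℕ.+-identityʳ m)))))))
    where
    lemma : ∀ a → (a ℤ.* 1ℤ) ℤ.* 1ℤ ≡ 1ℤ ℤ.* a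
    lemma = ℤ-Solver.solve-∀

  fromℤ-↧* : ∀ r → fromℤ (+ ℚ.↧ₙ r) ℚ.* r ≡ fromℤ (ℚ.↥ r)
  fromℤ-↧* r@record{} = ℚ.toℚᵘ-injective (ℚᵘ.≃-trans (ℚ.toℚᵘ-homo-* (fromℤ (+ ℚ.↧ₙ r)) r)
    (ℚᵘ.*≡* (≡.trans (lemma (ℚ.↧ r) (ℚ.↥ r)) (≡.cong (λ d → ℚ.↥ r ℤ.* + d) (≡.sym (ℕ.*-identityˡ (ℚ.↧ₙ r)))))))
    where
    lemma : ∀ d m → (d ℤ.* m) ℤ.* 1ℤ ≡ m ℤ.* d
    lemma = ℤ-Solver.solve-∀

-- Integers inside a field of characteristic zero

module FieldProperties {c ℓ₁ ℓ₂} (F : ℚ-Field c ℓ₁ ℓ₂) where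

  open NumberFields F hiding (zero) public
  open Algebra.Morphism.Structures.RingMorphisms.IsRingHomomorphism ι-isRingHomomorphism public
    using () renaming (+-homo to ι-+; *-homo to ι-*; 0#-homo to ι-0; 1#-homo to ι-1; -‿homo to ι-neg)
  open CommutativeRing commutativeRing public using (commutativeSemiring; +-commutativeMonoid; ring; +-group)
  open import Algebra.Properties.Ring ring public
    using (-0#≈0#; -‿distribˡ-*)
  open import Algebra.Properties.Group +-group public
    using () renaming (x∙y⁻¹≈ε⇒x≈y to x-y≈0⇒x≈y)
  open import Algebra.Properties.CommutativeSemiring.Exp commutativeSemiring public
    using (^-congˡ; ^-congʳ; ^-homo-*; ^-assocʳ; ^-distrib-*)
  open import Relation.Binary.Reasoning.Setoid setoid public

  ι-cong : ∀ {a b} → a ≡ b → ι a ≈ ι b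
  ι-cong ≡.refl = refl

  ιℤ-cong : ∀ {a b} → a ≡ b → ιℤ a ≈ ιℤ b
  ιℤ-cong ≡.refl = refl

  ιℤ-+ : ∀ a b → ιℤ (a ℤ.+ b) ≈ ιℤ a + ιℤ b
  ιℤ-+ a b = trans (ι-cong (FromInteger.fromℤ-+ a b)) (ι-+ (fromℤ a) (fromℤ b))

  ιℤ-* : ∀ a b → ιℤ (a ℤ.* b) ≈ ιℤ a * ιℤ b
  ιℤ-* a b = trans (ι-cong (FromInteger.fromℤ-* a b)) (ι-* (fromℤ a) (fromℤ b))

  ιℤ-neg : ∀ a → ιℤ (ℤ.- a) ≈ - ιℤ a
  ιℤ-neg a = trans (ι-cong (FromInteger.fromℤ-neg a)) (ι-neg (fromℤ a))

  ιℤ-0 : ιℤ (+ 0) ≈ 0#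
  ιℤ-0 = ι-0

  ιℤ-1 : ιℤ 1ℤ ≈ 1#
  ιℤ-1 = ι-1

  ιℤ-morphism : ℤ.+-*-rawRing -Raw-AlmostCommutative⟶ fromCommutativeRing commutativeRing
  ιℤ-morphism = record
    { ⟦_⟧    = ιℤ
    ; +-homo = ιℤ-+
    ; *-homo = ιℤ-*
    ; -‿homo = ιℤ-neg
    ; 0-homo = ιℤ-0
    ; 1-homo = ιℤ-1
    }

  ιℤ-≟ : ∀ a b → Maybe (ιℤ a ≈ ιℤ b)
  ιℤ-≟ a b with a ℤ.≟ b
  ... | yes a≡b = just (ιℤ-cong a≡b)
  ... | no  _   = nothing

  open RingSolver ℤ.+-*-rawRing (fromCommutativeRing commutativeRing) ιℤ-morphism ιℤ-≟ public
    using (solve; _:+_; _:*_; _:-_; :-_; _:=_; con)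

  ιℕ-+ : ∀ m n → ιℕ (m ℕ.+ n) ≈ ιℕ m + ιℕ n
  ιℕ-+ m n = ιℤ-+ (+ m) (+ n)

  ιℕ-* : ∀ m n → ιℕ (m ℕ.* n) ≈ ιℕ m * ιℕ n
  ιℕ-* m n = trans (ιℤ-cong (ℤ.pos-* m n)) (ιℤ-* (+ m) (+ n))

  ιℕ-^ : ∀ m n → ιℕ (m ℕ.^ n) ≈ ιℕ m ^ n
  ιℕ-^ m zero    = ιℤ-1
  ιℕ-^ m (suc n) = trans (ιℕ-* m (m ℕ.^ n)) (*-congˡ (ιℕ-^ m n))

  -- Nontriviality comes from the apartness: 1 - 0 is invertible, so 1 is apart from 0, and
  -- apartness is irreflexive.
  1≉0 : ¬ 1# ≈ 0#
  1≉0 1≈0 = #-irrefl 1≈0 (invertible⇒# (1# , inverse , trans (*-comm _ _) inverse))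
    where
    inverse : 1# * (1# - 0#) ≈ 1#
    inverse = trans (*-identityˡ _) (trans (+-congˡ -0#≈0#) (+-identityʳ _))

  ιℕ-inverse : ∀ n .{{_ : NonZero n}} → ιℕ n * ι (1ℤ ℚ./ n) ≈ 1#
  ιℕ-inverse n = trans (sym (ι-* (fromℤ (+ n)) (1ℤ ℚ./ n))) (trans (ι-cong (FromInteger.fromℤ*1/ n)) ι-1)

  cancel : ∀ {u w} → u * w ≈ 1# → ∀ {x y} → u * x ≈ u * y → x ≈ y
  cancel {u} {w} u*w≈1 {x} {y} ux≈uy = begin
    x           ≈⟨ *-identityˡ x ⟨
    1# * x      ≈⟨ *-congʳ u*w≈1 ⟨
    u * w * x   ≈⟨ solve 3 (λ u w x → u :* w :* x := w :* (u :* x)) refl u w x ⟩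
    w * (u * x) ≈⟨ *-congˡ ux≈uy ⟩
    w * (u * y) ≈⟨ solve 3 (λ u w x → u :* w :* x := w :* (u :* x)) refl u w y ⟨
    u * w * y   ≈⟨ *-congʳ u*w≈1 ⟩
    1# * y      ≈⟨ *-identityˡ y ⟩
    y           ∎

  ιℕ-cancel : ∀ n .{{_ : NonZero n}} {x y} → ιℕ n * x ≈ ιℕ n * y → x ≈ y
  ιℕ-cancel n = cancel (ιℕ-inverse n)

  ιℕ≉0 : ∀ n .{{_ : NonZero n}} → ¬ ιℕ n ≈ 0#
  ιℕ≉0 n n≈0 = 1≉0 (trans (sym (ιℕ-inverse n)) (trans (*-congʳ n≈0) (zeroˡ _)))

  ιℤ≈0⇒≡0 : ∀ a → ιℤ a ≈ 0# → a ≡ + 0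
  ιℤ≈0⇒≡0 (+ zero)     _   = ≡.refl
  ιℤ≈0⇒≡0 (ℤ.+[1+ n ]) a≈0 = contradiction a≈0 (ιℕ≉0 (suc n))
  ιℤ≈0⇒≡0 (ℤ.-[1+ n ]) a≈0 = contradiction
    (trans (ιℤ-neg ℤ.-[1+ n ]) (trans (-‿cong a≈0) -0#≈0#)) (ιℕ≉0 (suc n))

  ιℤ-injective : ∀ {a b} → ιℤ a ≈ ιℤ b → a ≡ b
  ιℤ-injective {a} {b} a≈b = ℤ.i-j≡0⇒i≡j a b (ιℤ≈0⇒≡0 (a ℤ.- b) (begin
    ιℤ (a ℤ.- b)      ≈⟨ ιℤ-+ a (ℤ.- b) ⟩
    ιℤ a + ιℤ (ℤ.- b) ≈⟨ +-cong a≈b (ιℤ-neg b) ⟩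
    ιℤ b - ιℤ b       ≈⟨ -‿inverseʳ _ ⟩
    0#                ∎))

  open import Algebra.Properties.Semiring.Mult semiring public using () renaming (_×_ to _·_)

  ·≈ιℕ* : ∀ m w → m · w ≈ ιℕ m * w
  ·≈ιℕ* zero    w = sym (trans (*-congʳ ιℤ-0) (zeroˡ w))
  ·≈ιℕ* (suc m) w = begin
    w + m · w               ≈⟨ +-cong (sym (*-identityˡ w)) (·≈ιℕ* m w) ⟩
    1# * w + ιℕ m * w       ≈⟨ distribʳ w 1# (ιℕ m) ⟨
    (1# + ιℕ m) * w         ≈⟨ *-congʳ (trans (ιℕ-+ 1 m) (+-congʳ ιℤ-1)) ⟨
    ιℕ (suc m) * w          ∎

-- Integral elements over a subring, and their closure under ring operations

module Integrality {c ℓ₁ ℓ₂} (F : ℚ-Field c ℓ₁ ℓ₂) where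

  open FieldProperties F

  record IsSubring {ℓ} (C : Pred Carrier ℓ) : Set (c ⊔ ℓ₁ ⊔ ℓ) where
    field
      resp : ∀ {x y} → x ≈ y → C x → C y
      0∈   : C 0#
      1∈   : C 1#
      +∈   : ∀ {x y} → C x → C y → C (x + y)
      *∈   : ∀ {x y} → C x → C y → C (x * y)
      -∈   : ∀ {x} → C x → C (- x)

    -1∈ : C (- 1#)
    -1∈ = -∈ 1∈

    ^∈ : ∀ {x} n → C x → C (x ^ n)
    ^∈ zero    Cx = 1∈
    ^∈ (suc n) Cx = *∈ Cx (^∈ n Cx)

    ∸∈ : ∀ {x y} → C x → C y → C (x - y)
    ∸∈ Cx Cy = +∈ Cx (-∈ Cy)

  record IsSubmodule {ℓ ℓ′} (C : Pred Carrier ℓ) (M : Pred Carrier ℓ′) : Set (c ⊔ ℓ₁ ⊔ ℓ ⊔ ℓ′) where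
    field
      resp : ∀ {x y} → x ≈ y → M x → M y
      0∈   : M 0#
      +∈   : ∀ {x y} → M x → M y → M (x + y)
      *∈   : ∀ {a x} → C a → M x → M (a * x)

  -- The combinations of 1, x, …, x^(d-1) with coefficients in C, in Horner form.
  data Low {ℓ} (C : Pred Carrier ℓ) (x : Carrier) : ℕ → Pred Carrier (c ⊔ ℓ₁ ⊔ ℓ) where
    nil  : ∀ {y} → y ≈ 0# → Low C x 0 y
    cons : ∀ {d y} a z → C a → Low C x d z → y ≈ a + x * z → Low C x (suc d) y

  Polynomial : ∀ {ℓ} → Pred Carrier ℓ → Carrier → Pred Carrier (c ⊔ ℓ₁ ⊔ ℓ)
  Polynomial C x y = ∃[ d ] Low C x d y

  -- A monic equation with its leading power moved to the other side. Over ℤ this is integrality,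
  -- over ℚ algebraicity.
  Algebraic : ∀ {ℓ} → Pred Carrier ℓ → Pred Carrier (c ⊔ ℓ₁ ⊔ ℓ)
  Algebraic C x = ∃[ d ] Low C x d (x ^ d)

  -- The coefficients satisfy an arbitrary predicate rather than lie in a ring, since elimination
  -- takes them in `Low C x d`, which need not be closed under products.
  data Span {ℓ} (A : Pred Carrier ℓ) : List Carrier → Pred Carrier (c ⊔ ℓ₁ ⊔ ℓ) where
    nil  : ∀ {y} → y ≈ 0# → Span A [] y
    cons : ∀ {b bs y} a m → A a → Span A bs m → y ≈ a * b + m → Span A (b ∷ bs) y

  polynomial⊆ : ∀ {ℓ ℓ′} {C : Pred Carrier ℓ} {S : Pred Carrier ℓ′} → IsSubring S → (∀ {a} → C a → S a) →
                ∀ {x y} → S x → Polynomial C x y → S y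
  polynomial⊆ S-subring C⊆S Sx (_ , nil y≈0) = resp (sym y≈0) 0∈
    where open IsSubring S-subring
  polynomial⊆ S-subring C⊆S Sx (suc d , cons a z Ca Lz y≈) =
    resp (sym y≈) (+∈ (C⊆S Ca) (*∈ Sx (polynomial⊆ S-subring C⊆S Sx (d , Lz))))
    where open IsSubring S-subring

  module _ {ℓ} {C : Pred Carrier ℓ} where

    low-resp : ∀ {x d y y′} → y ≈ y′ → Low C x d y → Low C x d y′
    low-resp y≈y′ (nil y≈0)             = nil (trans (sym y≈y′) y≈0)
    low-resp y≈y′ (cons a z Ca Lz y≈) = cons a z Ca Lz (trans (sym y≈y′) y≈)

    low-cong : ∀ {x x′ d y} → x ≈ x′ → Low C x d y → Low C x′ d y
    low-cong x≈x′ (nil y≈0)           = nil y≈0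
    low-cong x≈x′ (cons a z Ca Lz y≈) =
      cons a z Ca (low-cong x≈x′ Lz) (trans y≈ (+-congˡ (*-congʳ x≈x′)))

    span-resp : ∀ {bs y y′} → y ≈ y′ → Span C bs y → Span C bs y′
    span-resp y≈y′ (nil y≈0)           = nil (trans (sym y≈y′) y≈0)
    span-resp y≈y′ (cons a m Ca Sm y≈) = cons a m Ca Sm (trans (sym y≈y′) y≈)

    span-0 : C 0# → ∀ bs → Span C bs 0#
    span-0 C0 []       = nil refl
    span-0 C0 (b ∷ bs) = cons 0# 0# C0 (span-0 C0 bs) (sym (trans (+-identityʳ _) (zeroˡ b)))

    span-+ : (∀ {a a′} → C a → C a′ → C (a + a′)) →
             ∀ {bs y y′} → Span C bs y → Span C bs y′ → Span C bs (y + y′)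
    span-+ C+ (nil y≈0) (nil y′≈0) = nil (trans (+-cong y≈0 y′≈0) (+-identityˡ 0#))
    span-+ C+ {b ∷ bs} (cons a m Ca Sm y≈) (cons a′ m′ Ca′ Sm′ y′≈) =
      cons (a + a′) (m + m′) (C+ Ca Ca′) (span-+ C+ Sm Sm′)
        (trans (+-cong y≈ y′≈) (solve 5 (λ a a′ b m m′ →
          (a :* b :+ m) :+ (a′ :* b :+ m′) := (a :+ a′) :* b :+ (m :+ m′)) refl a a′ b m m′))

    span-* : ∀ {ℓ′} {C′ : Pred Carrier ℓ′} {s} → (∀ {a} → C a → C′ (s * a)) →
             ∀ {bs y} → Span C bs y → Span C′ bs (s * y)
    span-* {s = s} sC⊆C′ (nil y≈0) = nil (trans (*-congˡ y≈0) (zeroʳ s))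
    span-* {s = s} sC⊆C′ {b ∷ bs} (cons a m Ca Sm y≈) =
      cons (s * a) (s * m) (sC⊆C′ Ca) (span-* sC⊆C′ Sm)
        (trans (*-congˡ y≈) (trans (distribˡ s _ m) (+-congʳ (sym (*-assoc s a b)))))

    span-map : ∀ {ℓ′} {C′ : Pred Carrier ℓ′} → (∀ {a} → C a → C′ a) →
               ∀ {bs y} → Span C bs y → Span C′ bs y
    span-map C⊆C′ (nil y≈0)           = nil y≈0
    span-map C⊆C′ (cons a m Ca Sm y≈) = cons a m (C⊆C′ Ca) (span-map C⊆C′ Sm) y≈

    span-++ˡ : C 0# → ∀ {bs} bs′ {y} → Span C bs y → Span C (bs ++ bs′) y
    span-++ˡ C0 bs′ (nil y≈0)           = span-resp (sym y≈0) (span-0 C0 bs′)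
    span-++ˡ C0 bs′ (cons a m Ca Sm y≈) = cons a m Ca (span-++ˡ C0 bs′ Sm) y≈

    span-∈ : C 0# → ∀ {a b bs} → C a → b ∈ bs → Span C bs (a * b)
    span-∈ C0 {a} {b} {_ ∷ bs} Ca (here ≡.refl) = cons a 0# Ca (span-0 C0 bs) (sym (+-identityʳ _))
    span-∈ C0 {a} {b} {b′ ∷ bs} Ca (there b∈bs) =
      cons 0# (a * b) C0 (span-∈ C0 Ca b∈bs) (sym (trans (+-congʳ (zeroˡ b′)) (+-identityˡ _)))

  module Over {ℓ} {C : Pred Carrier ℓ} (C-subring : IsSubring C) where

    open IsSubring C-subring using (resp; 0∈; 1∈; +∈; *∈; -∈; -1∈)

    low-0 : ∀ {x} d → Low C x d 0#
    low-0 zero    = nil refl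
    low-0 {x} (suc d) = cons 0# 0# 0∈ (low-0 d) (sym (trans (+-identityˡ _) (zeroʳ x)))

    low-const : ∀ {x a} d → C a → Low C x (suc d) a
    low-const {x} {a} d Ca = cons a 0# Ca (low-0 d) (sym (trans (+-congˡ (zeroʳ x)) (+-identityʳ a)))

    low-+ : ∀ {x d y y′} → Low C x d y → Low C x d y′ → Low C x d (y + y′)
    low-+ (nil y≈0) (nil y′≈0) = nil (trans (+-cong y≈0 y′≈0) (+-identityˡ 0#))
    low-+ {x} (cons a z Ca Lz y≈) (cons a′ z′ Ca′ Lz′ y′≈) =
      cons (a + a′) (z + z′) (+∈ Ca Ca′) (low-+ Lz Lz′)
        (trans (+-cong y≈ y′≈) (solve 5 (λ a a′ x z z′ →
          (a :+ x :* z) :+ (a′ :+ x :* z′) := (a :+ a′) :+ x :* (z :+ z′)) refl a a′ x z z′))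

    low-scale : ∀ {x d s y} → C s → Low C x d y → Low C x d (s * y)
    low-scale {s = s} Cs (nil y≈0) = nil (trans (*-congˡ y≈0) (zeroʳ s))
    low-scale {x} {s = s} Cs (cons a z Ca Lz y≈) =
      cons (s * a) (s * z) (*∈ Cs Ca) (low-scale Cs Lz)
        (trans (*-congˡ y≈) (solve 4 (λ s a x z → s :* (a :+ x :* z) := s :* a :+ x :* (s :* z)) refl s a x z))

    low-isSubmodule : ∀ {x d} → IsSubmodule C (Low C x d)
    low-isSubmodule {d = d} = record { resp = low-resp ; 0∈ = low-0 d ; +∈ = low-+ ; *∈ = low-scale }

    low-neg : ∀ {x d y} → Low C x d y → Low C x d (- y)
    low-neg {y = y} Ly = low-resp (trans (sym (-‿distribˡ-* 1# y)) (-‿cong (*-identityˡ y))) (low-scale -1∈ Ly)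

    low-shift : ∀ {x d y} → Low C x d y → Low C x (suc d) (x * y)
    low-shift {y = y} Ly = cons 0# y 0∈ Ly (sym (+-identityˡ _))

    low-shift^ : ∀ {x d y} n → Low C x d y → Low C x (n ℕ.+ d) (x ^ n * y)
    low-shift^ zero    Ly = low-resp (sym (*-identityˡ _)) Ly
    low-shift^ (suc n) Ly = low-resp (sym (*-assoc _ _ _)) (low-shift (low-shift^ n Ly))

    low-suc : ∀ {x d y} → Low C x d y → Low C x (suc d) y
    low-suc (nil y≈0)           = low-resp (sym y≈0) (low-0 1)
    low-suc (cons a z Ca Lz y≈) = cons a z Ca (low-suc Lz) y≈

    low-weaken : ∀ {x d y} e → Low C x d y → Low C x (e ℕ.+ d) y
    low-weaken zero    Ly = Ly
    low-weaken (suc e) Ly = low-suc (low-weaken e Ly)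

    low-weakenʳ : ∀ {x d y} e → Low C x d y → Low C x (d ℕ.+ e) y
    low-weakenʳ {x} {d} {y} e Ly = ≡.subst (λ n → Low C x n y) (ℕ.+-comm e d) (low-weaken e Ly)

    low-* : ∀ {x d e y z} → Low C x d y → Low C x e z → Low C x (d ℕ.+ e) (y * z)
    low-* {e = e} {z = z} (nil y≈0) Lz = low-resp (sym (trans (*-congʳ y≈0) (zeroˡ z))) (low-0 e)
    low-* {x} {suc d} {e} {y} {z} (cons a y′ Ca Ly′ y≈) Lz = low-resp
      (sym (trans (*-congʳ y≈) (trans (distribʳ z a _) (+-congˡ (*-assoc x y′ z)))))
      (low-+ (low-weaken (suc d) (low-scale Ca Lz)) (low-shift (low-* Ly′ Lz)))

    low-^ : ∀ {x i d} → i ℕ.< d → Low C x d (x ^ i)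
    low-^ {i = zero}  {suc d} _   = low-const d 1∈
    low-^ {i = suc i} {suc d} i<d = low-shift (low-^ (ℕ.s<s⁻¹ i<d))

    -- Induction principle for `Low`: membership in a submodule need only be checked on the powers
    -- of x.
    low-elim : ∀ {ℓ′} {M : Pred Carrier ℓ′} → IsSubmodule C M →
               ∀ {x d y} → (∀ i → i ℕ.< d → M (x ^ i)) → Low C x d y → M y
    low-elim {M = M} M-sub M^ Ly = M-resp (*-identityˡ _) (go 1# M^′ Ly)
      where
      open IsSubmodule M-sub renaming (resp to M-resp; 0∈ to M-0; +∈ to M-+; *∈ to M-*)

      M^′ = λ i i<d → M-resp (sym (*-identityˡ _)) (M^ i i<d)

      -- The accumulator `t` is the power of x already pulled out of the Horner form.
      go : ∀ {x d y} t → (∀ i → i ℕ.< d → M (t * x ^ i)) → Low C x d y → M (t * y)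
      go t Mt^ (nil y≈0) = M-resp (sym (trans (*-congˡ y≈0) (zeroʳ t))) M-0
      go {x} t Mt^ (cons a z Ca Lz y≈) =
        M-resp (trans (solve 4 (λ t a x z → a :* (t :* con (ℤ.+ 1)) :+ (t :* x) :* z := t :* (a :+ x :* z)) refl t a x z)
                      (*-congˡ (sym y≈)))
          (M-+ (M-* Ca (M-resp (*-congˡ (sym ιℤ-1)) (Mt^ 0 ℕ.z<s)))
               (go (t * x) (λ i i<d → M-resp (sym (*-assoc t x _)) (Mt^ (suc i) (ℕ.s<s i<d))) Lz))

    polynomial-isSubring : ∀ {x} → IsSubring (Polynomial C x)
    polynomial-isSubring {x} = record
      { resp = λ { y≈y′ (d , Ly) → d , low-resp y≈y′ Ly }
      ; 0∈   = 0 , low-0 0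
      ; 1∈   = 1 , low-const 0 1∈
      ; +∈   = λ { (d , Ly) (d′ , Ly′) → d ℕ.+ d′ ,
                 low-+ (low-weakenʳ d′ Ly) (low-weaken d Ly′) }
      ; *∈   = λ { (d , Ly) (d′ , Ly′) → d ℕ.+ d′ , low-* Ly Ly′ }
      ; -∈   = λ { (d , Ly) → d , low-neg Ly }
      }

    low-^≤ : ∀ {x d i} → Low C x d (x ^ d) → i ℕ.≤ d → Low C x d (x ^ i)
    low-^≤ xᵈ∈ i≤d with ℕ.m≤n⇒m<n∨m≡n i≤d
    ... | inj₁ i<d    = low-^ i<d
    ... | inj₂ ≡.refl = xᵈ∈

    -- Division with remainder by the monic relation of x: the combinations of 1, ..., x^(d-1) are
    -- stable under multiplication by x, because x · x^(d-1) = x^d is one of them; so they contain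
    -- every power of x.
    reduce : ∀ {x d y} → Low C x d (x ^ d) → Polynomial C x y → Low C x d y
    reduce {x} {d} xᵈ∈ (_ , Ly) = low-elim low-isSubmodule (λ i _ → power i) Ly
      where
      x*-isSubmodule : IsSubmodule C (λ y → Low C x d (x * y))
      x*-isSubmodule = record
        { resp = λ y≈y′ → low-resp (*-congˡ y≈y′)
        ; 0∈   = low-resp (sym (zeroʳ x)) (low-0 d)
        ; +∈   = λ Ly Lz → low-resp (sym (distribˡ x _ _)) (low-+ Ly Lz)
        ; *∈   = λ {a} {y} Ca Ly → low-resp (solve 3 (λ x a y → a :* (x :* y) := x :* (a :* y)) refl x a y)
                   (low-scale Ca Ly)
        }

      power : ∀ i → Low C x d (x ^ i)
      power zero    = low-^≤ xᵈ∈ ℕ.z≤n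
      power (suc i) = low-elim x*-isSubmodule (λ j j<d → low-^≤ xᵈ∈ j<d) (power i)

    -- The determinant trick: the relations x^d b = Σ l_j b_j, with l_j of degree
    -- less than d in x, persist (with d doubled) when a generator is eliminated.
    Relations : Carrier → ℕ → List Carrier → Set _
    Relations x d bs = ∀ {b} → b ∈ bs → Span (Low C x d) bs (x ^ d * b)

    eliminate : ∀ {x d b bs} → Relations x d (b ∷ bs) → Relations x (d ℕ.+ d) bs
    eliminate {x} {d} {b} {bs} rel {b′} b′∈bs with rel (here ≡.refl) | rel (there b′∈bs)
    ... | cons l m Ll Sm xᵈb≈ | cons k n Lk Sn xᵈb′≈ = span-resp (sym (begin
      x ^ (d ℕ.+ d) * b′
        ≈⟨ trans (*-congʳ (^-homo-* x d d)) (*-assoc _ _ _) ⟩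
      X * (X * b′)                                ≈⟨ *-congˡ xᵈb′≈ ⟩
      X * (k * b + n)
        ≈⟨ solve 4 (λ X k b n → X :* (k :* b :+ n) := k :* (X :* b) :+ X :* n) refl X k b n ⟩
      k * (X * b) + X * n                         ≈⟨ +-congʳ (*-congˡ xᵈb≈) ⟩
      k * (l * b + m) + X * n
        -- Here X b = l b + m and X b′ = k b + n. The terms are arranged so that `b` occurs only in
        -- k b + n, which is X b′ again. The coefficients left are X l, those of k m, and those of
        -- (X - l) n, all of degree below 2 d.
        ≈⟨ solve 6 (λ X k l b m n → k :* (l :* b :+ m) :+ X :* n :=
                                                       l :* (k :* b :+ n) :+ ((k :* m :+ (X :- l) :* n))) refl X k l b m n ⟩
      l * (k * b + n) + (k * m + (X - l) * n)     ≈⟨ +-congʳ (*-congˡ (sym xᵈb′≈)) ⟩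
      l * (X * b′) + (k * m + (X - l) * n)
        ≈⟨ +-congʳ (solve 3 (λ l X b′ → l :* (X :* b′) := (X :* l) :* b′) refl l X b′) ⟩
      (X * l) * b′ + (k * m + (X - l) * n)        ∎))
      (span-+ low-+ (span-∈ (low-0 (d ℕ.+ d)) (low-shift^ d Ll) b′∈bs)
        (span-+ low-+ (span-* (low-* Lk) Sm)
          (span-* (λ {a} La → low-resp (sym (distribʳ a X (- l))) (low-+ (low-shift^ d La) (low-* (low-neg Ll) La))) Sn)))
      where X = x ^ d

    -- With 1 placed last, the relation that survives all eliminations involves x alone: x^d · 1 = l
    -- · 1 with l of degree below d.
    relations⇒algebraic : ∀ {x d} bs → Relations x d (bs ++ [ 1# ]) → Algebraic C x
    relations⇒algebraic (b ∷ bs) rel = relations⇒algebraic bs (eliminate rel)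
    relations⇒algebraic {d = d} [] rel with rel (here ≡.refl)
    ... | cons l m Ll (nil m≈0) xᵈ≈ = d , low-resp (begin
      l          ≈⟨ *-identityʳ l ⟨
      l * 1#     ≈⟨ +-identityʳ _ ⟨
      l * 1# + 0# ≈⟨ +-congˡ m≈0 ⟨
      l * 1# + m ≈⟨ xᵈ≈ ⟨
      _          ≈⟨ *-identityʳ _ ⟩
      _          ∎) Ll

    span-stable : ∀ {x y bs bs′} → (∀ {b} → b ∈ bs → Span C bs′ (x * b)) → Span C bs y → Span C bs′ (x * y)
    span-stable {x} {bs′ = bs′} x*bs (nil y≈0) =
      span-resp (sym (trans (*-congˡ y≈0) (zeroʳ x))) (span-0 0∈ bs′)
    span-stable {x} {bs = b ∷ _} x*bs (cons a m Ca Sm y≈) = span-resp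
      (sym (trans (*-congˡ y≈) (solve 4 (λ x a b m → x :* (a :* b :+ m) := a :* (x :* b) :+ x :* m) refl x a b m)))
      (span-+ +∈ (span-* (*∈ Ca) (x*bs (here ≡.refl))) (span-stable (λ b∈ → x*bs (there b∈)) Sm))

    -- Since 1 lies in the span, so does x · 1; hence 1 can be added as a redundant generator, and
    -- stability supplies relations with d = 1.
    stable⇒algebraic : ∀ {x} bs → (∀ {b} → b ∈ bs → Span C bs (x * b)) → Span C bs 1# → Algebraic C x
    stable⇒algebraic {x} bs x*bs 1∈bs = relations⇒algebraic {d = 1} bs rel
      where
      rel : Relations x 1 (bs ++ [ 1# ])
      rel {b} b∈ = span-map (low-const 0) (span-++ˡ 0∈ [ 1# ]
        (span-resp (*-congʳ (sym (*-identityʳ x)))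
          ([ x*bs , (λ { (here ≡.refl) → span-stable x*bs 1∈bs }) ]′ (∈-++⁻ bs b∈))))

    -- The finitely many products x^i y^j with i < d and j < e span a module that contains 1 and is
    -- stable under x and under y, hence under x + y and x y.
    module _ {x y d e} (xᵈ∈ : Low C x d (x ^ d)) (yᵉ∈ : Low C y e (y ^ e)) where

      private
        products : List Carrier
        products = cartesianProductWith _*_ (map (x ^_) (upTo d)) (map (y ^_) (upTo e))

        S : Pred Carrier _
        S = Span C products

        span-isSubmodule : IsSubmodule C S
        span-isSubmodule = record
          { resp = span-resp ; 0∈ = span-0 0∈ products ; +∈ = span-+ +∈ ; *∈ = λ Ca → span-* (*∈ Ca) }

        open IsSubmodule span-isSubmodule using () renaming (+∈ to S-+; *∈ to S-*)

        times-isSubmodule : ∀ t → IsSubmodule C (λ m → S (m * t))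
        times-isSubmodule t = record
          { resp = λ m≈m′ → span-resp (*-congʳ m≈m′)
          ; 0∈   = span-resp (sym (zeroˡ t)) (span-0 0∈ products)
          ; +∈   = λ Sm Sm′ → span-resp (sym (distribʳ t _ _)) (S-+ Sm Sm′)
          ; *∈   = λ Ca Sm → span-resp (sym (*-assoc _ _ t)) (S-* Ca Sm)
          }

        power-product : ∀ i → i ℕ.< d → ∀ j → j ℕ.< e → S (x ^ i * y ^ j)
        power-product i i<d j j<e = span-resp (*-identityˡ _) (span-∈ 0∈ 1∈
          (∈-cartesianProductWith⁺ _*_ (∈-map⁺ (x ^_) (∈-upTo⁺ i<d)) (∈-map⁺ (y ^_) (∈-upTo⁺ j<e))))

        low-product : ∀ {l m} → Low C x d l → Low C y e m → S (l * m)
        low-product {l} {m} Ll Lm = low-elim (times-isSubmodule m) (λ i i<d →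
          span-resp (*-comm m (x ^ i)) (low-elim (times-isSubmodule (x ^ i)) (λ j j<e →
            span-resp (*-comm (x ^ i) (y ^ j)) (power-product i i<d j j<e)) Lm)) Ll

        1∈products : S 1#
        1∈products = span-resp (*-identityʳ 1#) (low-product (low-^≤ xᵈ∈ ℕ.z≤n) (low-^≤ yᵉ∈ ℕ.z≤n))

        generators : ∀ {b} → b ∈ products → ∃[ i ] ∃[ j ] i ℕ.< d × j ℕ.< e × b ≡ x ^ i * y ^ j
        generators b∈ with ∈-cartesianProductWith⁻ _*_ (map (x ^_) (upTo d)) (map (y ^_) (upTo e)) b∈
        ... | _ , _ , xⁱ∈ , yʲ∈ , b≡ with ∈-map⁻ (x ^_) xⁱ∈ | ∈-map⁻ (y ^_) yʲ∈
        ...   | i , i∈ , ≡.refl | j , j∈ , ≡.refl = i , j , ∈-upTo⁻ i∈ , ∈-upTo⁻ j∈ , b≡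

        x* : ∀ {b} → b ∈ products → S (x * b)
        x* b∈ with generators b∈
        ... | i , j , i<d , j<e , ≡.refl = span-resp (*-assoc x _ _) (low-product (low-^≤ xᵈ∈ i<d) (low-^ j<e))

        y* : ∀ {b} → b ∈ products → S (y * b)
        y* b∈ with generators b∈
        ... | i , j , i<d , j<e , ≡.refl = span-resp
          (solve 3 (λ y xⁱ yʲ → xⁱ :* (y :* yʲ) := y :* (xⁱ :* yʲ)) refl y (x ^ i) (y ^ j))
          (low-product (low-^ i<d) (low-^≤ yᵉ∈ j<e))

      algebraic-+ : Algebraic C (x + y)
      algebraic-+ = stable⇒algebraic products
        (λ {b} b∈ → span-resp (sym (distribʳ b x y)) (S-+ (x* b∈) (y* b∈))) 1∈products

      algebraic-* : Algebraic C (x * y)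
      algebraic-* = stable⇒algebraic products
        (λ {b} b∈ → span-resp (sym (*-assoc x y b)) (span-stable x* (y* b∈))) 1∈products

    const⇒algebraic : ∀ {a} → C a → Algebraic C a
    const⇒algebraic {a} Ca = 1 , low-const 0 (resp (sym (*-identityʳ a)) Ca)

    algebraic-isSubring : IsSubring (Algebraic C)
    algebraic-isSubring = record
      { resp = λ { x≈y (d , xᵈ∈) → d , low-cong x≈y (low-resp (^-congˡ d x≈y) xᵈ∈) }
      ; 0∈   = const⇒algebraic 0∈
      ; 1∈   = const⇒algebraic 1∈
      ; +∈   = λ { (_ , xᵈ∈) (_ , yᵉ∈) → algebraic-+ xᵈ∈ yᵉ∈ }
      ; *∈   = λ { (_ , xᵈ∈) (_ , yᵉ∈) → algebraic-* xᵈ∈ yᵉ∈ }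
      ; -∈   = λ { {x} (_ , xᵈ∈) → let e , eq = algebraic-* (proj₂ (const⇒algebraic -1∈)) xᵈ∈ in
                   let -1x≈ = trans (sym (-‿distribˡ-* 1# x)) (-‿cong (*-identityˡ x)) in
                   e , low-cong -1x≈ (low-resp (^-congˡ e -1x≈) eq) }
      }

-- Divisibility by primes in ℤ

module IntegerDivisibility where

  open Arithmetic using (prime∤1)

  primeℤ∣* : ∀ {q} a b → Prime q → + q ℤ.∣ a ℤ.* b → + q ℤ.∣ a ⊎ + q ℤ.∣ b
  primeℤ∣* {q} a b q-prime q∣ab = Sum.map ℤ.∣ᵤ⇒∣ ℤ.∣ᵤ⇒∣
    (euclidsLemma ℤ.∣ a ∣ ℤ.∣ b ∣ q-prime (≡.subst (q ℕ.∣_) (ℤ.abs-* a b) (ℤ.∣⇒∣ᵤ q∣ab)))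

  primeℤ∣^ : ∀ {q} a n → Prime q → + q ℤ.∣ a ℤ.^ n → + q ℤ.∣ a
  primeℤ∣^ a zero    q-prime q∣1 = contradiction (ℤ.∣⇒∣ᵤ q∣1) (prime∤1 q-prime)
  primeℤ∣^ a (suc n) q-prime q∣  = [ id , primeℤ∣^ a n q-prime ]′ (primeℤ∣* a (a ℤ.^ n) q-prime q∣)

  primeℤ∣n*⇒∣ : ∀ {q n a} → Prime q → ¬ q ℕ.∣ n → + q ℤ.∣ + n ℤ.* a → + q ℤ.∣ a
  primeℤ∣n*⇒∣ {n = n} {a} q-prime q∤n q∣ =
    [ (λ q∣n → contradiction (ℤ.∣⇒∣ᵤ q∣n) q∤n) , id ]′ (primeℤ∣* (+ n) a q-prime q∣)

  *-∣ : ∀ m n {a b} → b ≡ + m ℤ.* a → + n ℤ.∣ a → + (m ℕ.* n) ℤ.∣ b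
  *-∣ m n {a} b≡ma n∣a = ≡.subst₂ ℤ._∣_ (≡.sym (ℤ.pos-* m n)) (≡.sym b≡ma) (ℤ.*-monoʳ-∣ (+ m) {+ n} {a} n∣a)

  i-j+j≡i : ∀ i j → i ℤ.- j ℤ.+ j ≡ i
  i-j+j≡i = ℤ-Solver.solve-∀

  n<q^n : ∀ {q} → 1 ℕ.< q → ∀ n → n ℕ.< q ℕ.^ n
  n<q^n {q} 1<q zero    = ℕ.z<s
  n<q^n {q} 1<q (suc n) = ℕ.≤-<-trans (n<q^n 1<q n) (ℕ.^-monoʳ-< q 1<q (ℕ.n<1+n n))

  -- A positive m is smaller than q^m, so q^m cannot divide it. This ends the descent for linear
  -- independence.
  infinitely-divisible⇒≡0 : ∀ {q a} → Prime q → (∀ n → + (q ℕ.^ n) ℤ.∣ a) → a ≡ + 0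
  infinitely-divisible⇒≡0 {q} {a} q-prime q^∣a = ℤ.∣i∣≡0⇒i≡0 (∣a∣≡0 ℤ.∣ a ∣ (λ n → ℤ.∣⇒∣ᵤ (q^∣a n)))
    where
    ∣a∣≡0 : ∀ m → (∀ n → q ℕ.^ n ℕ.∣ m) → m ≡ 0
    ∣a∣≡0 zero      _   = ≡.refl
    ∣a∣≡0 m@(suc _) q^∣ = contradiction (q^∣ m)
      (ℕ.>⇒∤ (n<q^n (ℕ.nonTrivial⇒n>1 q {{prime⇒nonTrivial q-prime}}) m))

-- Coefficient vectors versus Horner forms, and algebraic integers

module Polynomials {c ℓ₁ ℓ₂} (F : ℚ-Field c ℓ₁ ℓ₂) where

  open FieldProperties F
  open Integrality F
  open IntegerDivisibility

  Image : ∀ {a} {A : Set a} → (A → Carrier) → Pred Carrier _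
  Image φ y = ∃[ a ] y ≈ φ a

  module _ {a} {A : Set a} (φ : A → Carrier) where

    polynomial-suc : ∀ {n} (f : Vector A (suc n)) x →
                     polynomial φ f x ≈ φ (head f) + x * polynomial φ (tail f) x
    polynomial-suc f x = +-cong (*-identityʳ _) (trans
      (sum-cong-≋ (λ i → solve 3 (λ a x xⁱ → a :* (x :* xⁱ) := x :* (a :* xⁱ)) refl (φ (f (suc i))) x (x ^ toℕ i)))
      (sym (*-distribˡ-sum x (λ i → φ (f (suc i)) * x ^ toℕ i))))
      where open import Algebra.Properties.Semiring.Sum semiring using (sum-cong-≋; *-distribˡ-sum)

    low⇒polynomial : ∀ {x d y} → Low (Image φ) x d y → Σ[ f ∈ Vector A d ] y ≈ polynomial φ f x
    low⇒polynomial (nil y≈0) = Vector.[] , y≈0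
    low⇒polynomial {x} (cons a z (k , a≈) Lz y≈) =
      let f , z≈ = low⇒polynomial Lz in
      k Vector.∷ f , trans y≈ (trans (+-cong a≈ (*-congˡ z≈)) (sym (polynomial-suc (k Vector.∷ f) x)))

    polynomial⇒low : ∀ {x d} (f : Vector A d) → Low (Image φ) x d (polynomial φ f x)
    polynomial⇒low {d = zero}  f = nil refl
    polynomial⇒low {x} {suc d} f =
      cons (φ (head f)) (polynomial φ (tail f) x) (head f , refl) (polynomial⇒low (tail f)) (polynomial-suc f x)

    module _ {_⊕_ _⊗_ : A → A → A} (φ-+ : ∀ a b → φ (a ⊕ b) ≈ φ a + φ b) (φ-* : ∀ a b → φ (a ⊗ b) ≈ φ a * φ b) where

      polynomial-+ : ∀ {n} (f g : Vector A n) x →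
                     polynomial φ (λ i → f i ⊕ g i) x ≈ polynomial φ f x + polynomial φ g x
      polynomial-+ {zero}  f g x = sym (+-identityˡ 0#)
      polynomial-+ {suc n} f g x = begin
        polynomial φ (λ i → f i ⊕ g i) x                ≈⟨ polynomial-suc (λ i → f i ⊕ g i) x ⟩
        φ (f₀ ⊕ g₀) + x * polynomial φ (λ i → f (suc i) ⊕ g (suc i)) x
          ≈⟨ +-cong (φ-+ f₀ g₀) (*-congˡ (polynomial-+ (tail f) (tail g) x)) ⟩
        (φ f₀ + φ g₀) + x * (pf + pg)
          ≈⟨ solve 5 (λ f₀ g₀ x pf pg → (f₀ :+ g₀) :+ x :* (pf :+ pg) :=
               (f₀ :+ x :* pf) :+ (g₀ :+ x :* pg))
               refl (φ f₀) (φ g₀) x pf pg ⟩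
        (φ f₀ + x * pf) + (φ g₀ + x * pg)
          ≈⟨ +-cong (polynomial-suc f x) (polynomial-suc g x) ⟨
        polynomial φ f x + polynomial φ g x             ∎
        where
        f₀ = head f
        g₀ = head g
        pf = polynomial φ (tail f) x
        pg = polynomial φ (tail g) x

      polynomial-scale : ∀ {n} s (f : Vector A n) x → polynomial φ (λ i → s ⊗ f i) x ≈ φ s * polynomial φ f x
      polynomial-scale {zero}  s f x = sym (zeroʳ _)
      polynomial-scale {suc n} s f x = begin
        polynomial φ (λ i → s ⊗ f i) x             ≈⟨ polynomial-suc (λ i → s ⊗ f i) x ⟩
        φ (s ⊗ f₀) + x * polynomial φ (λ i → s ⊗ f (suc i)) x
          ≈⟨ +-cong (φ-* s f₀) (*-congˡ (polynomial-scale s (tail f) x)) ⟩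
        φ s * φ f₀ + x * (φ s * pf)
          ≈⟨ solve 4 (λ s f₀ x pf → s :* f₀ :+ x :* (s :* pf) :=
               s :* (f₀ :+ x :* pf)) refl (φ s) (φ f₀) x pf ⟩
        φ s * (φ f₀ + x * pf)                      ≈⟨ *-congˡ (polynomial-suc f x) ⟨
        φ s * polynomial φ f x                     ∎
        where
        f₀ = head f
        pf = polynomial φ (tail f) x

    polynomial-cong : ∀ {n} {f g : Vector A n} → (∀ i → φ (f i) ≈ φ (g i)) → ∀ x → polynomial φ f x ≈ polynomial φ g x
    polynomial-cong {zero}  f≗g x = refl
    polynomial-cong {suc n} f≗g x = +-cong (*-congʳ (f≗g zero)) (sum-cong-≋ (λ i → *-congʳ (f≗g (suc i))))
      where open import Algebra.Properties.Semiring.Sum semiring using (sum-cong-≋)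

  ℤ∈ : Pred Carrier _
  ℤ∈ = Image ιℤ

  ℚ∈ : Pred Carrier _
  ℚ∈ = Image ι

  ℤ∈-isSubring : IsSubring ℤ∈
  ℤ∈-isSubring = record
    { resp = λ { x≈y (a , x≈) → a , trans (sym x≈y) x≈ }
    ; 0∈   = + 0 , sym ιℤ-0
    ; 1∈   = 1ℤ , sym ιℤ-1
    ; +∈   = λ { (a , x≈) (b , y≈) → a ℤ.+ b , trans (+-cong x≈ y≈) (sym (ιℤ-+ a b)) }
    ; *∈   = λ { (a , x≈) (b , y≈) → a ℤ.* b , trans (*-cong x≈ y≈) (sym (ιℤ-* a b)) }
    ; -∈   = λ { (a , x≈) → ℤ.- a , trans (-‿cong x≈) (sym (ιℤ-neg a)) }
    }

  ℚ∈-isSubring : IsSubring ℚ∈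
  ℚ∈-isSubring = record
    { resp = λ { x≈y (a , x≈) → a , trans (sym x≈y) x≈ }
    ; 0∈   = ℚ.0ℚ , sym ι-0
    ; 1∈   = ℚ.1ℚ , sym ι-1
    ; +∈   = λ { (a , x≈) (b , y≈) → a ℚ.+ b , trans (+-cong x≈ y≈) (sym (ι-+ a b)) }
    ; *∈   = λ { (a , x≈) (b , y≈) → a ℚ.* b , trans (*-cong x≈ y≈) (sym (ι-* a b)) }
    ; -∈   = λ { (a , x≈) → ℚ.- a , trans (-‿cong x≈) (sym (ι-neg a)) }
    }

  module Overℤ = Over ℤ∈-isSubring
  module Overℚ = Over ℚ∈-isSubring

  Int : Pred Carrier _
  Int = Algebraic ℤ∈

  integral⇒algebraic : ∀ {x} → Integral x → Int x
  integral⇒algebraic {x} (n , f , eq) = n , low-resp (begin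
    - P               ≈⟨ +-identityˡ _ ⟨
    0# - P            ≈⟨ +-congʳ eq ⟨
    x ^ n + P - P     ≈⟨ solve 2 (λ xⁿ P → xⁿ :+ P :- P := xⁿ) refl (x ^ n) P ⟩
    x ^ n             ∎) (Overℤ.low-neg (polynomial⇒low ιℤ f))
    where P = polynomial ιℤ f x

  algebraic⇒integral : ∀ {x} → Int x → Integral x
  algebraic⇒integral {x} (n , xⁿ∈) =
    let f , eq = low⇒polynomial ιℤ (Overℤ.low-neg xⁿ∈) in n , f , trans (+-congˡ (sym eq)) (-‿inverseʳ _)

  module Int where
    open IsSubring (Overℤ.algebraic-isSubring) public

    int : ∀ a → Int (ιℤ a)
    int a = Overℤ.const⇒algebraic (a , refl)

  ιℤ-^ : ∀ a n → ιℤ (a ℤ.^ n) ≈ ιℤ a ^ n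
  ιℤ-^ a zero    = ιℤ-1
  ιℤ-^ a (suc n) = trans (ιℤ-* a (a ℤ.^ n)) (*-congˡ (ιℤ-^ a n))

  -- As `y` has degree below d in h, multiplying by q^d turns every power of h into a power of q h =
  -- t and still leaves a factor q over. With S = ℤ this is the core of the rational root theorem;
  -- with S = ℤ[β] it shows that ℓ y is nilpotent modulo ℓ.
  clear-denominators : ∀ {ℓ ℓ′} {C : Pred Carrier ℓ} {S : Pred Carrier ℓ′} → IsSubring S → (∀ {a} → C a → S a) →
                       ∀ {q t h} → S q → S t → q * h ≈ t →
                       ∀ {d y} → Low C h d y → ∃[ s ] S s × q ^ d * y ≈ q * s
  clear-denominators {C = C} {S} S-subring C⊆S {q} {t} {h} Sq St qh≈t = go
    where
    open IsSubring S-subring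

    go : ∀ {d y} → Low C h d y → ∃[ s ] S s × q ^ d * y ≈ q * s
    go (nil y≈0) = 0# , 0∈ , trans (trans (*-congˡ y≈0) (zeroʳ _)) (sym (zeroʳ q))
    go {suc d} (cons a z Ca Lz y≈) =
      let s , Ss , eq = go Lz in
      q ^ d * a + t * s , +∈ (*∈ (^∈ d Sq) (C⊆S Ca)) (*∈ St Ss) , (begin
        q * q ^ d * _                      ≈⟨ *-congˡ y≈ ⟩
        q * q ^ d * (a + h * z)            ≈⟨ solve 5 (λ q qᵈ a h z → q :* qᵈ :* (a :+ h :* z) :=
                                                q :* (qᵈ :* a) :+ q :* h :* (qᵈ :* z)) refl q (q ^ d) a h z ⟩
        q * (q ^ d * a) + q * h * (q ^ d * z) ≈⟨ +-congˡ (*-cong qh≈t eq) ⟩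
        q * (q ^ d * a) + t * (q * s)
          ≈⟨ solve 5 (λ q qᵈ a t s → q :* (qᵈ :* a) :+ t :* (q :* s) :=
                                                q :* (qᵈ :* a :+ t :* s)) refl q (q ^ d) a t s ⟩
        q * (q ^ d * a + t * s)            ∎)

  -- The integral equation of h = t / q, multiplied by q^n, shows that q divides t^n.
  rational-root : ∀ {q h t} → Prime q → Int h → ιℕ q * h ≈ ιℤ t → + q ℤ.∣ t
  rational-root {q} {h} {t} q-prime (n , hⁿ∈) qh≈t
    with clear-denominators ℤ∈-isSubring id (+ q , refl) (t , refl) qh≈t hⁿ∈
  ... | s , (k , s≈k) , eq = primeℤ∣^ t n q-prime (divides k (ιℤ-injective (begin
    ιℤ (t ℤ.^ n)     ≈⟨ ιℤ-^ t n ⟩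
    ιℤ t ^ n         ≈⟨ ^-congˡ n qh≈t ⟨
    (ιℕ q * h) ^ n   ≈⟨ ^-distrib-* (ιℕ q) h n ⟩
    ιℕ q ^ n * h ^ n ≈⟨ eq ⟩
    ιℕ q * s         ≈⟨ *-comm _ _ ⟩
    s * ιℕ q         ≈⟨ *-congʳ s≈k ⟩
    ιℤ k * ιℕ q      ≈⟨ ιℤ-* k (+ q) ⟨
    ιℤ (k ℤ.* + q)   ∎)))

-- The ring ℤ[β] with β^p = Q squarefree, and its maximality away from p

module Radical {c ℓ₁ ℓ₂} (F : ℚ-Field c ℓ₁ ℓ₂) where

  open FieldProperties F
  open Integrality F
  open Polynomials F
  open Arithmetic hiding (^-distrib-*)
  open IntegerDivisibility

  module Root (n : ℕ) (p-prime : Prime (suc n))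
    (Q : ℕ) {{Q≢0 : NonZero Q}} (Q-squarefree : ∀ {ℓ} → Prime ℓ → ℓ ℕ.∣ Q → ℓ ∥ Q)
    {q₀ : ℕ} (q₀-prime : Prime q₀) (q₀∣Q : q₀ ℕ.∣ Q)
    (β : Carrier) (β^p≈Q : β ^ suc n ≈ ιℕ Q)
    where

    p : ℕ
    p = suc n

    R : Pred Carrier _
    R = Polynomial ℤ∈ β

    module R = IsSubring (Overℤ.polynomial-isSubring {β})

    const∈R : ∀ a → R (ιℤ a)
    const∈R a = 1 , Overℤ.low-const 0 (a , refl)

    β∈R : R β
    β∈R = 2 , low-resp (*-identityʳ β) (Overℤ.low-^ {i = 1} (ℕ.s<s ℕ.z<s))

    βᵖ∈low : Low ℤ∈ β p (β ^ p)
    βᵖ∈low = low-resp (sym β^p≈Q) (Overℤ.low-const n (+ Q , refl))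

    infix 8 ⟦_⟧

    ⟦_⟧ : ∀ {d} → Vector ℤ d → Carrier
    ⟦ f ⟧ = polynomial ιℤ f β

    ⟦⟧∈R : ∀ {d} (f : Vector ℤ d) → R ⟦ f ⟧
    ⟦⟧∈R {d} f = d , polynomial⇒low ιℤ f

    coordinates : ∀ {y} → R y → Σ[ f ∈ Vector ℤ p ] y ≈ ⟦ f ⟧
    coordinates Ry = low⇒polynomial ιℤ (Overℤ.reduce βᵖ∈low Ry)

    β-integral : Int β
    β-integral = p , βᵖ∈low

    R⊆Int : ∀ {y} → R y → Int y
    R⊆Int = polynomial⊆ Overℤ.algebraic-isSubring Overℤ.const⇒algebraic β-integral

    quotients : ∀ {d ℓ} {f : Vector ℤ d} → (∀ i → + ℓ ℤ.∣ f i) →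
                Σ[ g ∈ Vector ℤ d ] (∀ i → f i ≡ + ℓ ℤ.* g i) × ⟦ f ⟧ ≈ ιℕ ℓ * ⟦ g ⟧
    quotients {ℓ = ℓ} {f} ℓ∣f = g , f≡ℓg , trans
      (polynomial-cong ιℤ (λ i → ιℤ-cong (f≡ℓg i)) β)
      (polynomial-scale ιℤ ιℤ-+ ιℤ-* (+ ℓ) g β)
      where
      g = λ i → ℤ.quotient (ℓ∣f i)
      f≡ℓg : ∀ i → f i ≡ + ℓ ℤ.* g i
      f≡ℓg i = ≡.trans (ℤ._∣_.equality (ℓ∣f i)) (ℤ.*-comm (g i) (+ ℓ))

    -- Q′ c = β w gives (Q′ c)ᵖ = Q wᵖ, a multiple of q.
    β∣⇒q∣ : ∀ {q a w} → Prime q → ((Q′ , _) : q ∥ Q) → Int w → ιℕ Q′ * ιℤ a ≈ β * w → + q ℤ.∣ a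
    β∣⇒q∣ {q} {a} {w} q-prime (Q′ , Q≡qQ′ , q∤Q′) w-int Q′a≈βw =
      primeℤ∣n*⇒∣ q-prime q∤Q′ (primeℤ∣^ (+ Q′ ℤ.* a) p q-prime
        (rational-root q-prime (Int.*∈ (Int.int (+ Q′)) (Int.^∈ p w-int)) (begin
          ιℕ q * (ιℕ Q′ * w ^ p)   ≈⟨ *-assoc _ _ _ ⟨
          ιℕ q * ιℕ Q′ * w ^ p     ≈⟨ *-congʳ (ιℕ-* q Q′) ⟨
          ιℕ (q ℕ.* Q′) * w ^ p    ≈⟨ *-congʳ (trans β^p≈Q (ιℤ-cong (≡.cong ℤ.+_ Q≡qQ′))) ⟨
          β ^ p * w ^ p            ≈⟨ ^-distrib-* β w p ⟨
          (β * w) ^ p              ≈⟨ ^-congˡ p Q′a≈βw ⟨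
          (ιℕ Q′ * ιℤ a) ^ p       ≈⟨ ^-congˡ p (ιℤ-* (+ Q′) a) ⟨
          ιℤ (+ Q′ ℤ.* a) ^ p      ≈⟨ ιℤ-^ (+ Q′ ℤ.* a) p ⟨
          ιℤ ((+ Q′ ℤ.* a) ℤ.^ p)  ∎)))

    -- Eisenstein's criterion at q: it yields both q-maximality of ℤ[β] and,
    -- for z = 0, the linear independence of the powers of β.
    eisenstein : ∀ {q} → Prime q → q ∥ Q → ∀ d j (f : Vector ℤ d) {z} → j ℕ.+ d ≡ p → Int z →
                 ιℕ q * z ≈ β ^ j * ⟦ f ⟧ → ∀ i → + q ℤ.∣ f i
    eisenstein {q} q-prime q∥Q@(Q′ , Q≡qQ′ , _) (suc d) j f {z} j+d≡p z-int qz≈ = λ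
      { zero    → q∣f₀
      ; (suc i) → eisenstein q-prime q∥Q d (suc j) (f ∘ suc) (≡.trans (≡.sym (ℕ.+-suc j d)) j+d≡p) z′-int qz′≈ i }
      where
      f₀ = ιℤ (f zero)
      G = ⟦ f ∘ suc ⟧

      Q≈ : ιℕ Q ≈ ιℕ q * ιℕ Q′
      Q≈ = trans (ιℤ-cong (≡.cong ℤ.+_ Q≡qQ′)) (ιℕ-* q Q′)

      Q≈βʲβᵈ : ιℕ Q ≈ β ^ j * β ^ suc d
      Q≈βʲβᵈ = trans (sym β^p≈Q) (trans (^-congʳ β (≡.sym j+d≡p)) (^-homo-* β j (suc d)))

      -- Multiplying the hypothesis by Q′ β^(d+1) produces q Q′ = Q on the left and β^j β^(d+1) =
      -- β^p = Q on the right. Cancelling Q removes β^j without inverting β.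
      βᵈz≈ : β ^ suc d * z ≈ ιℕ Q′ * (f₀ + β * G)
      βᵈz≈ = ιℕ-cancel Q (begin
        ιℕ Q * (β ^ suc d * z)              ≈⟨ *-congʳ Q≈ ⟩
        ιℕ q * ιℕ Q′ * (β ^ suc d * z)
          ≈⟨ solve 4 (λ q Q′ B z → q :* Q′ :* (B :* z) :=
               Q′ :* B :* (q :* z)) refl (ιℕ q) (ιℕ Q′) (β ^ suc d) z ⟩
        ιℕ Q′ * β ^ suc d * (ιℕ q * z)
          ≈⟨ *-congˡ (trans qz≈ (*-congˡ (polynomial-suc ιℤ f β))) ⟩
        ιℕ Q′ * β ^ suc d * (β ^ j * (f₀ + β * G))
          ≈⟨ solve 4 (λ Q′ B J P → Q′ :* B :* (J :* P) :=
               J :* B :* (Q′ :* P)) refl (ιℕ Q′) (β ^ suc d) (β ^ j) (f₀ + β * G) ⟩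
        β ^ j * β ^ suc d * (ιℕ Q′ * (f₀ + β * G)) ≈⟨ *-congʳ Q≈βʲβᵈ ⟨
        ιℕ Q * (ιℕ Q′ * (f₀ + β * G))       ∎)

      -- The power β^(d+1) contains at least one β, so Q′ f₀ is β times an algebraic integer.
      q∣f₀ : + q ℤ.∣ f zero
      q∣f₀ = β∣⇒q∣ q-prime q∥Q
        (Int.∸∈ (Int.*∈ (Int.^∈ d β-integral) z-int) (Int.*∈ (Int.int (+ Q′)) (R⊆Int (⟦⟧∈R (f ∘ suc))))) (begin
        ιℕ Q′ * f₀
          ≈⟨ solve 4 (λ Q′ f₀ β G → Q′ :* f₀ :=
               Q′ :* (f₀ :+ β :* G) :- β :* (Q′ :* G)) refl (ιℕ Q′) f₀ β G ⟩
        ιℕ Q′ * (f₀ + β * G) - β * (ιℕ Q′ * G)          ≈⟨ +-congʳ βᵈz≈ ⟨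
        β * β ^ d * z - β * (ιℕ Q′ * G)
          ≈⟨ solve 4 (λ β B z H → β :* B :* z :- β :* H :=
               β :* (B :* z :- H)) refl β (β ^ d) z (ιℕ Q′ * G) ⟩
        β * (β ^ d * z - ιℕ Q′ * G)                     ∎)

      k = ℤ.quotient q∣f₀
      f₀≈ : f₀ ≈ ιℤ k * ιℕ q
      f₀≈ = trans (ιℤ-cong (ℤ._∣_.equality q∣f₀)) (ιℤ-* k (+ q))

      -- The constant term, now known to be q k, is moved to the left; what remains is the same
      -- situation for the tail, with j raised by one.
      z′ = z - ιℤ k * β ^ j

      z′-int : Int z′
      z′-int = Int.∸∈ z-int (Int.*∈ (Int.int k) (Int.^∈ j β-integral))

      qz′≈ : ιℕ q * z′ ≈ β ^ suc j * G
      qz′≈ = begin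
        ιℕ q * z′
          ≈⟨ solve 4 (λ q z k J → q :* (z :- k :* J) :=
               q :* z :- J :* (k :* q)) refl (ιℕ q) z (ιℤ k) (β ^ j) ⟩
        ιℕ q * z - β ^ j * (ιℤ k * ιℕ q)
          ≈⟨ +-cong (trans qz≈ (*-congˡ (polynomial-suc ιℤ f β))) (-‿cong (*-congˡ (sym f₀≈))) ⟩
        β ^ j * (f₀ + β * G) - β ^ j * f₀
          ≈⟨ solve 4 (λ J f₀ β G → J :* (f₀ :+ β :* G) :- J :* f₀ :=
               β :* J :* G) refl (β ^ j) f₀ β G ⟩
        β ^ suc j * G                               ∎

    eisenstein₀ : ∀ {q y} → Prime q → q ∥ Q → Int y → (f : Vector ℤ p) → ιℕ q * y ≈ ⟦ f ⟧ → ∀ i → + q ℤ.∣ f i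
    eisenstein₀ q-prime q∥Q y-int f eq =
      eisenstein q-prime q∥Q p 0 f ≡.refl y-int (trans eq (sym (*-identityˡ _)))

    -- One use of Eisenstein only shows that `q₀` divides all coefficients. The quotients satisfy
    -- the same relation, so every power of `q₀` divides them.
    independent : ∀ (f : Vector ℤ p) → ⟦ f ⟧ ≈ 0# → ∀ i → f i ≡ + 0
    independent f f≈0 i = infinitely-divisible⇒≡0 q₀-prime (λ k → q₀^∣ k f f≈0 i)
      where
      instance q₀≢0 = prime⇒nonZero q₀-prime

      q₀^∣ : ∀ k (f : Vector ℤ p) → ⟦ f ⟧ ≈ 0# → ∀ i → + (q₀ ℕ.^ k) ℤ.∣ f i
      q₀^∣ zero    f f≈0 i = divides (f i) (≡.sym (ℤ.*-identityʳ (f i)))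
      q₀^∣ (suc k) f f≈0 i =
        let g , f≡q₀g , f≈q₀g = quotients (eisenstein₀ q₀-prime (Q-squarefree q₀-prime q₀∣Q) Int.0∈ f (trans (zeroʳ _) (sym f≈0)))
            g≈0 = ιℕ-cancel q₀ (trans (sym f≈q₀g) (trans f≈0 (sym (zeroʳ _))))
        in *-∣ q₀ (q₀ ℕ.^ k) (f≡q₀g i) (q₀^∣ k g g≈0 i)

    coordinates-unique : ∀ (f g : Vector ℤ p) → ⟦ f ⟧ ≈ ⟦ g ⟧ → ∀ i → f i ≡ g i
    coordinates-unique f g f≈g i = ℤ.i-j≡0⇒i≡j (f i) (g i) (independent h h≈0 i)
      where
      h : Vector ℤ p
      h i = f i ℤ.- g i

      h+g≡f : ∀ i → h i ℤ.+ g i ≡ f i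
      h+g≡f i = i-j+j≡i (f i) (g i)

      h≈0 : ⟦ h ⟧ ≈ 0#
      h≈0 = begin
        ⟦ h ⟧                              ≈⟨ solve 2 (λ h g → h := h :+ g :- g) refl ⟦ h ⟧ ⟦ g ⟧ ⟩
        ⟦ h ⟧ + ⟦ g ⟧ - ⟦ g ⟧              ≈⟨ +-congʳ (polynomial-+ ιℤ ιℤ-+ ιℤ-* h g β) ⟨
        ⟦ (λ i → h i ℤ.+ g i) ⟧ - ⟦ g ⟧
          ≈⟨ +-congʳ (trans (polynomial-cong ιℤ (λ i → ιℤ-cong (h+g≡f i)) β) f≈g) ⟩
        ⟦ g ⟧ - ⟦ g ⟧                      ≈⟨ -‿inverseʳ ⟦ g ⟧ ⟩
        0#                                 ∎

    _∣R_ : ℕ → Pred Carrier _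
    ℓ ∣R y = ∃[ w ] R w × y ≈ ιℕ ℓ * w

    -- Uniqueness of coordinates makes divisibility in ℤ[β] coordinatewise.
    ∣R⇒∣ : ∀ {ℓ} (f : Vector ℤ p) → ℓ ∣R ⟦ f ⟧ → ∀ i → + ℓ ℤ.∣ f i
    ∣R⇒∣ {ℓ} f (w , Rw , f≈ℓw) i =
      let g , w≈g = coordinates Rw in
      divides (g i) (≡.trans
        (coordinates-unique f (λ i → + ℓ ℤ.* g i)
          (trans f≈ℓw (trans (*-congˡ w≈g) (sym (polynomial-scale ιℤ ιℤ-+ ιℤ-* (+ ℓ) g β)))) i)
        (ℤ.*-comm (+ ℓ) (g i)))

    ∣⇒∣R : ∀ {ℓ} (f : Vector ℤ p) → (∀ i → + ℓ ℤ.∣ f i) → ℓ ∣R ⟦ f ⟧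
    ∣⇒∣R f ℓ∣f = let g , _ , f≈ = quotients {f = f} ℓ∣f in ⟦ g ⟧ , ⟦⟧∈R g , f≈

    module Reduced {ℓ : ℕ} (ℓ-prime : Prime ℓ) (ℓ≢p : ℓ ≢ p) (ℓ∤Q : ¬ ℓ ℕ.∣ Q) where

      open Frobenius.Closed commutativeSemiring R R.0∈ R.1∈ R.+∈ R.*∈ using (frobenius)

      infix 4 _≋_
      _≋_ : Carrier → Carrier → Set _
      x ≋ y = ∃[ w ] R w × x ≈ y + ιℕ ℓ * w

      ≈⇒≋ : ∀ {x y} → x ≈ y → x ≋ y
      ≈⇒≋ x≈y = 0# , R.0∈ , trans x≈y (sym (trans (+-congˡ (zeroʳ _)) (+-identityʳ _)))

      ≋-trans : ∀ {x y z} → x ≋ y → y ≋ z → x ≋ z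
      ≋-trans {x} {y} {z} (v , Rv , x≈) (w , Rw , y≈) = w + v , R.+∈ Rw Rv ,
        trans x≈ (trans (+-congʳ y≈) (solve 4 (λ z ℓ w v → z :+ ℓ :* w :+ ℓ :* v := z :+ ℓ :* (w :+ v)) refl z (ιℕ ℓ) w v))

      ≋-+ : ∀ {x y x′ y′} → x ≋ y → x′ ≋ y′ → x + x′ ≋ y + y′
      ≋-+ {y = y} {y′ = y′} (v , Rv , x≈) (w , Rw , y≈) = v + w , R.+∈ Rv Rw ,
        trans (+-cong x≈ y≈) (solve 5 (λ y y′ ℓ w v → y :+ ℓ :* v :+ (y′ :+ ℓ :* w) := y :+ y′ :+ ℓ :* (v :+ w)) refl y y′ (ιℕ ℓ) w v)

      ≋-* : ∀ {x y x′ y′} → R y → R x′ → x ≋ y → x′ ≋ y′ → x * x′ ≋ y * y′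
      ≋-* {x} {y} {x′} {y′} Ry Rx′ (v , Rv , x≈) (w , Rw , x′≈) = v * x′ + y * w , R.+∈ (R.*∈ Rv Rx′) (R.*∈ Ry Rw) , (begin
        x * x′                                ≈⟨ *-congʳ x≈ ⟩
        (y + ιℕ ℓ * v) * x′
          ≈⟨ solve 4 (λ y ℓ v x′ → (y :+ ℓ :* v) :* x′ :=
               y :* x′ :+ ℓ :* (v :* x′)) refl y (ιℕ ℓ) v x′ ⟩
        y * x′ + ιℕ ℓ * (v * x′)              ≈⟨ +-congʳ (*-congˡ x′≈) ⟩
        y * (y′ + ιℕ ℓ * w) + ιℕ ℓ * (v * x′)
          ≈⟨ solve 5 (λ y y′ ℓ w vx → y :* (y′ :+ ℓ :* w) :+ ℓ :* vx :=
               y :* y′ :+ ℓ :* (vx :+ y :* w)) refl y y′ (ιℕ ℓ) w (v * x′) ⟩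
        y * y′ + ιℕ ℓ * (v * x′ + y * w)      ∎)

      ≋-^ : ∀ {x y} k → R x → R y → x ≋ y → x ^ k ≋ y ^ k
      ≋-^ zero    Rx Ry x≋y = ≈⇒≋ refl
      ≋-^ (suc k) Rx Ry x≋y = ≋-* Ry (R.^∈ k Rx) x≋y (≋-^ k Rx Ry x≋y)

      frobenius^ : ∀ k {x y} → R x → R y → (x + y) ^ (ℓ ℕ.^ k) ≋ x ^ (ℓ ℕ.^ k) + y ^ (ℓ ℕ.^ k)
      frobenius^ zero    Rx Ry = ≈⇒≋ (trans (*-identityʳ _) (sym (+-cong (*-identityʳ _) (*-identityʳ _))))
      frobenius^ (suc k) {x} {y} Rx Ry =
        ≋-trans (≈⇒≋ (power (x + y)))
          (≋-trans (≋-^ ℓ (R.^∈ m (R.+∈ Rx Ry)) (R.+∈ Rxᵐ Ryᵐ) (frobenius^ k Rx Ry))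
            (≋-trans step (≈⇒≋ (sym (+-cong (power x) (power y))))))
        where
        m = ℓ ℕ.^ k
        Rxᵐ = R.^∈ m Rx
        Ryᵐ = R.^∈ m Ry

        power : ∀ t → t ^ (ℓ ℕ.* m) ≈ (t ^ m) ^ ℓ
        power t = trans (^-congʳ t (ℕ.*-comm ℓ m)) (sym (^-assocʳ t m ℓ))

        step : (x ^ m + y ^ m) ^ ℓ ≋ (x ^ m) ^ ℓ + (y ^ m) ^ ℓ
        step = let w , Rw , eq = frobenius ℓ-prime Rxᵐ Ryᵐ in w , Rw , trans eq (+-congˡ (·≈ιℕ* ℓ w))

      -- A single Frobenius would permute the powers of β, up to powers of Q. With L ≡ 1 modulo p,
      -- which Fermat provides as p does not divide ℓ, each β^i goes to a multiple of itself and
      -- coordinates stay in place.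
      L : ℕ
      L = ℓ ℕ.^ n

      unit : ∃[ s ] L ≡ 1 ℕ.+ p ℕ.* s
      unit = Fermat.fermat-unit p-prime (λ p∣ℓ → ℓ≢p (≡.sym (prime∣prime p-prime ℓ-prime p∣ℓ)))

      s : ℕ
      s = proj₁ unit

      β^L : β ^ L ≈ β * ιℕ (Q ℕ.^ s)
      β^L = begin
        β ^ L                ≈⟨ ^-congʳ β (proj₂ unit) ⟩
        β * β ^ (p ℕ.* s)    ≈⟨ *-congˡ (^-assocʳ β p s) ⟨
        β * (β ^ p) ^ s      ≈⟨ *-congˡ (^-congˡ s β^p≈Q) ⟩
        β * ιℕ Q ^ s         ≈⟨ *-congˡ (ιℕ-^ Q s) ⟨
        β * ιℕ (Q ℕ.^ s)     ∎

      -- Raising to the power L multiplies the coordinates (up to their L-th powers) by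
      -- powers of Q, which are units modulo ℓ.
      twist : ∀ {d} (f : Vector ℤ d) →
              Σ[ g ∈ Vector ℤ d ] (⟦ f ⟧ ^ L ≋ ⟦ g ⟧) × (∀ i → + ℓ ℤ.∣ g i → + ℓ ℤ.∣ f i)
      twist {zero}  f = f , ≈⇒≋ 0^L≈0 , λ ()
        where
        0^L≈0 : 0# ^ L ≈ 0#
        0^L≈0 = trans (^-congʳ 0# (proj₂ unit)) (zeroˡ _)
      twist {suc d} f with twist (f ∘ suc)
      ... | g , fL≋g , ∣g⇒∣f = h , fL≋h , ∣h⇒∣f
        where
        q = Q ℕ.^ s
        -- Each Horner step multiplies the tail by β^L = β Q^s, so the i-th coordinate collects the
        -- factor Q^(s i).
        h = f zero ℤ.^ L Vector.∷ λ i → + q ℤ.* g i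
        G = ⟦ f ∘ suc ⟧
        RG = ⟦⟧∈R (f ∘ suc)

        fL≋h : ⟦ f ⟧ ^ L ≋ ⟦ h ⟧
        fL≋h =
          ≋-trans (≈⇒≋ (^-congˡ L (polynomial-suc ιℤ f β)))
          (≋-trans (frobenius^ n (const∈R (f zero)) (R.*∈ β∈R RG))
          (≋-trans (≋-+ (≈⇒≋ (sym (ιℤ-^ (f zero) L)))
                        (≋-trans (≈⇒≋ (trans (^-distrib-* β G L) (*-congʳ β^L)))
                                 (≋-* (R.*∈ β∈R (const∈R (+ q))) (R.^∈ L RG) (≈⇒≋ refl) fL≋g)))
                   (≈⇒≋ (begin
            ιℤ (f zero ℤ.^ L) + β * ιℕ q * ⟦ g ⟧
              ≈⟨ +-congˡ (trans (*-assoc β (ιℕ q) ⟦ g ⟧) (*-congˡ (sym (polynomial-scale ιℤ ιℤ-+ ιℤ-* (+ q) g β)))) ⟩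
            ιℤ (f zero ℤ.^ L) + β * ⟦ (λ i → + q ℤ.* g i) ⟧ ≈⟨ polynomial-suc ιℤ h β ⟨
            ⟦ h ⟧                                       ∎))))

        ∣h⇒∣f : ∀ i → + ℓ ℤ.∣ h i → + ℓ ℤ.∣ f i
        ∣h⇒∣f zero    ℓ∣f₀^L = primeℤ∣^ (f zero) L ℓ-prime ℓ∣f₀^L
        ∣h⇒∣f (suc i) ℓ∣qgᵢ  = ∣g⇒∣f i (primeℤ∣n*⇒∣ ℓ-prime (λ ℓ∣q → ℓ∤Q (prime∣^ s ℓ-prime ℓ∣q)) ℓ∣qgᵢ)

      ∣R-resp : ∀ {x y} → x ≈ y → ℓ ∣R x → ℓ ∣R y
      ∣R-resp x≈y (w , Rw , x≈) = w , Rw , trans (sym x≈y) x≈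

      L-root : ∀ {y} → R y → ℓ ∣R (y ^ L) → ℓ ∣R y
      L-root {y} Ry (w , Rw , y^L≈) =
        let f , y≈f = coordinates Ry
            g , (v , Rv , f^L≈) , ∣g⇒∣f = twist f
            ℓ∣g = ∣R⇒∣ g (w - v , R.∸∈ Rw Rv , (begin
              ⟦ g ⟧
                ≈⟨ solve 3 (λ g ℓ v → g := g :+ ℓ :* v :- ℓ :* v) refl ⟦ g ⟧ (ιℕ ℓ) v ⟩
              ⟦ g ⟧ + ιℕ ℓ * v - ιℕ ℓ * v
                ≈⟨ +-congʳ (trans (sym f^L≈) (trans (^-congˡ L (sym y≈f)) y^L≈)) ⟩
              ιℕ ℓ * w - ιℕ ℓ * v
                ≈⟨ solve 3 (λ ℓ w v → ℓ :* w :- ℓ :* v := ℓ :* (w :- v)) refl (ιℕ ℓ) w v ⟩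
              ιℕ ℓ * (w - v)                    ∎))
        in ∣R-resp (sym y≈f) (∣⇒∣R f (λ i → ∣g⇒∣f i (ℓ∣g i)))

      L^k-root : ∀ k {y} → R y → ℓ ∣R (y ^ (L ℕ.^ k)) → ℓ ∣R y
      L^k-root zero    Ry ℓ∣ = ∣R-resp (*-identityʳ _) ℓ∣
      L^k-root (suc k) {y} Ry ℓ∣ = L^k-root k Ry (L-root (R.^∈ (L ℕ.^ k) Ry)
        (∣R-resp (trans (^-congʳ y (ℕ.*-comm L (L ℕ.^ k))) (sym (^-assocʳ y (L ℕ.^ k) L))) ℓ∣))

      -- Roots can be extracted only for exponents L^k. As m < L^m, the exponent m is first raised
      -- to L^m.
      reduced : ∀ {y} m → R y → ℓ ∣R (y ^ m) → ℓ ∣R y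
      reduced {y} m Ry (w , Rw , y^m≈) = L^k-root m Ry
        (y ^ (L ℕ.^ m ℕ.∸ m) * w , R.*∈ (R.^∈ (L ℕ.^ m ℕ.∸ m) Ry) Rw , (begin
          y ^ (L ℕ.^ m)
            ≈⟨ ^-congʳ y (≡.sym (ℕ.m∸n+n≡m (ℕ.<⇒≤ (n<q^n 1<L m)))) ⟩
          y ^ (L ℕ.^ m ℕ.∸ m ℕ.+ m)           ≈⟨ ^-homo-* y (L ℕ.^ m ℕ.∸ m) m ⟩
          y ^ (L ℕ.^ m ℕ.∸ m) * y ^ m         ≈⟨ *-congˡ y^m≈ ⟩
          y ^ (L ℕ.^ m ℕ.∸ m) * (ιℕ ℓ * w)
            ≈⟨ solve 3 (λ Y ℓ w → Y :* (ℓ :* w) :=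
                 ℓ :* (Y :* w)) refl (y ^ (L ℕ.^ m ℕ.∸ m)) (ιℕ ℓ) w ⟩
          ιℕ ℓ * (y ^ (L ℕ.^ m ℕ.∸ m) * w)    ∎))
        where
        -- Since p is at least 2, the exponent n = p - 1 of ℓ in `L` is positive.
        1<L : 1 ℕ.< L
        1<L = ℕ.^-monoʳ-< ℓ (ℕ.nonTrivial⇒n>1 ℓ {{prime⇒nonTrivial ℓ-prime}})
                (ℕ.s<s⁻¹ (ℕ.nonTrivial⇒n>1 p {{prime⇒nonTrivial p-prime}}))

    maximal-at : ∀ {ℓ y} → Prime ℓ → ℓ ≢ p → Int y → R (ιℕ ℓ * y) → R y
    maximal-at {ℓ} {y} ℓ-prime ℓ≢p y-int@(m , yᵐ∈) Rℓy = divide ℓ∣ℓy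
      where
      instance ℓ≢0 = prime⇒nonZero ℓ-prime

      divide : ℓ ∣R (ιℕ ℓ * y) → R y
      divide (w , Rw , ℓy≈ℓw) = R.resp (sym (ιℕ-cancel ℓ ℓy≈ℓw)) Rw

      ℓ∣ℓy : ℓ ∣R (ιℕ ℓ * y)
      ℓ∣ℓy with ℓ ℕ.∣? Q
      ... | yes ℓ∣Q =
        let f , ℓy≈f = coordinates Rℓy
            w , Rw , f≈ = ∣⇒∣R f (eisenstein₀ ℓ-prime (Q-squarefree ℓ-prime ℓ∣Q) y-int f ℓy≈f)
        in w , Rw , trans ℓy≈f f≈
      ... | no  ℓ∤Q =
        -- The integral equation of y, of degree m, puts ℓ^m y^m = (ℓ y)^m into ℓ ℤ[β].
        let w , Rw , eq = clear-denominators (Overℤ.polynomial-isSubring {β}) (λ { (a , x≈) → R.resp (sym x≈) (const∈R a) })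
                            (const∈R (+ ℓ)) Rℓy refl yᵐ∈
        in Reduced.reduced ℓ-prime ℓ≢p ℓ∤Q m Rℓy (w , Rw , trans (^-distrib-* (ιℕ ℓ) y m) eq)

    maximal : ∀ {y} ℓs → All Prime ℓs → All (_≢ p) ℓs → Int y → R (ιℕ (product ℓs) * y) → R y
    maximal []       []                 []            y-int Ry  = R.resp (trans (*-congʳ ιℤ-1) (*-identityˡ _)) Ry
    maximal {y} (ℓ ∷ ℓs) (ℓ-prime ∷ ℓs-prime) (ℓ≢p ∷ ℓs≢p) y-int RNy =
      maximal ℓs ℓs-prime ℓs≢p y-int (maximal-at ℓ-prime ℓ≢p (Int.*∈ (Int.int (+ product ℓs)) y-int)
        (R.resp (trans (*-congʳ (ιℕ-* ℓ (product ℓs))) (*-assoc _ _ _)) RNy))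

-- The index of a subgroup annihilates the quotient

module Lagrange {c ℓ₁ ℓ₂} (F : ℚ-Field c ℓ₁ ℓ₂) where

  open FieldProperties F
  open import Algebra.Properties.CommutativeMonoid.Sum +-commutativeMonoid
    using (∑-distrib-+; sum-permute; sum-replicate; sum-cong-≋)

  module Cosets {ℓ ℓ′} {G : Pred Carrier ℓ} {H : Pred Carrier ℓ′}
    (G-+ : ∀ {x y} → G x → G y → G (x + y))
    (G-neg : ∀ {x} → G x → G (- x))
    (H-resp : ∀ {x y} → x ≈ y → H x → H y)
    (H-0 : H 0#)
    (H-+ : ∀ {x y} → H x → H y → H (x + y))
    where

    sum∈H : ∀ {n} (f : Vector Carrier n) → (∀ i → H (f i)) → H (sum f)
    sum∈H {zero}  f Hf = H-0
    sum∈H {suc n} f Hf = H-+ (Hf zero) (sum∈H (f ∘ suc) (Hf ∘ suc))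

    -- Adding x permutes the cosets of H; hence the sum of x + r - r′, over the
    -- representatives r of the cosets and r′ of their translates, is n x.
    index*∈ : ∀ {n} → HasIndex G H n → ∀ {x} → G x → H (ιℕ n * x)
    index*∈ {n} (r , Gr , coset) {x} Gx = H-resp ∑≈nx (sum∈H f (λ i → translate∈H Gx i))
      where
      translate : ∀ {y} → G y → Fin n → Fin n
      translate Gy i = proj₁ (coset _ (G-+ Gy (Gr i)))

      translate∈H : ∀ {y} (Gy : G y) i → H (y + r i - r (translate Gy i))
      translate∈H Gy i = proj₁ (proj₂ (coset _ (G-+ Gy (Gr i))))

      same-coset : ∀ i j → H (r i - r j) → j ≡ i
      -- Both `i` and `j` index a representative of the coset of `r i`, so uniqueness identifies
      -- them.
      same-coset i j Hij with coset (r i) (Gr i)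
      ... | _ , _ , unique = ≡.trans (≡.sym (unique Hij)) (unique (H-resp (sym (-‿inverseʳ (r i))) H-0))

      translate-inverse : ∀ {y z} (Gy : G y) (Gz : G z) → y + z ≈ 0# → ∀ i → translate Gy (translate Gz i) ≡ i
      translate-inverse {y} {z} Gy Gz y+z≈0 i = same-coset i k (H-resp (begin
        (z + r i - r j) + (y + r j - r k)
          ≈⟨ solve 5 (λ y z i j k → (z :+ i :- j) :+ (y :+ j :- k) :=
               (y :+ z) :+ (i :- k)) refl y z (r i) (r j) (r k) ⟩
        (y + z) + (r i - r k)              ≈⟨ +-congʳ y+z≈0 ⟩
        0# + (r i - r k)                   ≈⟨ +-identityˡ _ ⟩
        r i - r k                          ∎) (H-+ (translate∈H Gz i) (translate∈H Gy j)))
        where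
        j = translate Gz i
        k = translate Gy j

      G-x = G-neg Gx

      π : Permutation′ n
      π = permutation (translate Gx) (translate G-x)
            (translate-inverse Gx G-x (-‿inverseʳ x)) (translate-inverse G-x Gx (-‿inverseˡ x))

      f : Vector Carrier n
      f i = x + r i - r (translate Gx i)

      r′ : Vector Carrier n
      r′ i = r (translate Gx i)

      ∑≈nx : sum f ≈ ιℕ n * x
      ∑≈nx = begin
        sum f
          ≈⟨ solve 2 (λ s t → s := s :+ t :- t) refl (sum f) (sum r′) ⟩
        sum f + sum r′ - sum r′                ≈⟨ +-congʳ (∑-distrib-+ f r′) ⟨
        sum (λ i → f i + r′ i) - sum r′
          ≈⟨ +-congʳ (sum-cong-≋ (λ i → solve 3 (λ x i j → x :+ i :- j :+ j :=
               x :+ i) refl x (r i) (r′ i))) ⟩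
        sum (λ i → x + r i) - sum r′           ≈⟨ +-congʳ (∑-distrib-+ (λ _ → x) r) ⟩
        sum {n} (λ _ → x) + sum r - sum r′
          ≈⟨ +-cong (+-cong (sum-replicate n) (sum-permute r π)) refl ⟩
        n · x + sum r′ - sum r′
          ≈⟨ solve 2 (λ s t → s :+ t :- t := s) refl (n · x) (sum r′) ⟩
        n · x                                  ≈⟨ ·≈ιℕ* n x ⟩
        ιℕ n * x                               ∎

-- Rational coefficients, and ℚ(θ) = ℚ[θ] for algebraic θ

module Rationals {c ℓ₁ ℓ₂} (F : ℚ-Field c ℓ₁ ℓ₂) where

  open FieldProperties F
  open Integrality F
  open Polynomials F

  ι≈0⇒≡0 : ∀ r → ι r ≈ 0# → r ≡ ℚ.0ℚ
  ι≈0⇒≡0 r r≈0 with r ℚ.≟ ℚ.0ℚ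
  ... | yes r≡0 = r≡0
  ... | no  r≢0 = contradiction (begin
    1#                  ≈⟨ ι-1 ⟨
    ι ℚ.1ℚ              ≈⟨ ι-cong (ℚ.*-inverseʳ r) ⟨
    ι (r ℚ.* ℚ.1/ r)    ≈⟨ ι-* r (ℚ.1/ r) ⟩
    ι r * ι (ℚ.1/ r)    ≈⟨ trans (*-congʳ r≈0) (zeroˡ _) ⟩
    0#                  ∎) 1≉0
    where instance _ = ℚ.≢-nonZero r≢0

  common-denominator : ∀ {d} (h : Vector ℚ d) →
                       ∃[ D ] NonZero D × Σ[ z ∈ Vector ℤ d ] (∀ i → ιℕ D * ι (h i) ≈ ιℤ (z i))
  common-denominator {zero}  h = 1 , _ , (λ ()) , λ ()
  common-denominator {suc d} h with common-denominator (h ∘ suc)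
  ... | D , D≢0 , z , eq = b ℕ.* D , ℕ.m*n≢0 b D {{_}} {{D≢0}} , z′ , eq′
    where
    b = ℚ.↧ₙ (h zero)

    z′ : Vector ℤ (suc d)
    z′ = + D ℤ.* ℚ.↥ (h zero) Vector.∷ λ i → + b ℤ.* z i

    eq′ : ∀ i → ιℕ (b ℕ.* D) * ι (h i) ≈ ιℤ (z′ i)
    eq′ zero    = begin
      ιℕ (b ℕ.* D) * ι (h zero)     ≈⟨ *-congʳ (ιℕ-* b D) ⟩
      ιℕ b * ιℕ D * ι (h zero)
        ≈⟨ solve 3 (λ b D h → b :* D :* h := D :* (b :* h)) refl (ιℕ b) (ιℕ D) (ι (h zero)) ⟩
      ιℕ D * (ιℕ b * ι (h zero))    ≈⟨ *-congˡ (sym (ι-* (fromℤ (+ b)) (h zero))) ⟩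
      ιℕ D * ι (fromℤ (+ b) ℚ.* h zero) ≈⟨ *-congˡ (ι-cong (FromInteger.fromℤ-↧* (h zero))) ⟩
      ιℕ D * ιℤ (ℚ.↥ (h zero))      ≈⟨ ιℤ-* (+ D) (ℚ.↥ (h zero)) ⟨
      ιℤ (z′ zero)                  ∎
    eq′ (suc i) = begin
      ιℕ (b ℕ.* D) * ι (h (suc i))  ≈⟨ trans (*-congʳ (ιℕ-* b D)) (*-assoc _ _ _) ⟩
      ιℕ b * (ιℕ D * ι (h (suc i))) ≈⟨ *-congˡ (eq i) ⟩
      ιℕ b * ιℤ (z i)               ≈⟨ ιℤ-* (+ b) (z i) ⟨
      ιℤ (+ b ℤ.* z i)              ∎

  -- The inverse `v` exists in the ambient field; the point is to find it among the polynomials in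
  -- g. In the monic equation of g, vanishing constant terms are stripped by cancelling g. The first
  -- nonzero constant k gives g (g^d - z) / k = 1. The case split is decidable because k is
  -- rational.
  algebraic-inverse : ∀ {g v} → g * v ≈ 1# → Algebraic ℚ∈ g → ∃[ w ] Polynomial ℚ∈ g w × g * w ≈ 1#
  algebraic-inverse {g} {v} gv≈1 (d , gᵈ∈) = go gᵈ∈ refl
    where
    module ℚ[g] = IsSubring (Overℚ.polynomial-isSubring {g})

    go : ∀ {d y} → Low ℚ∈ g d y → y ≈ g ^ d → ∃[ w ] Polynomial ℚ∈ g w × g * w ≈ 1#
    -- If every coefficient vanished, the equation would shrink to 1 = 0.
    go (nil y≈0) y≈1 = contradiction (trans (sym y≈1) y≈0) 1≉0
    go {suc d} (cons a z (k , a≈k) Lz y≈) y≈gᵈ⁺¹ with k ℚ.≟ ℚ.0ℚ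
    ... | yes ≡.refl = go Lz (cancel gv≈1 (begin
      g * z        ≈⟨ +-identityˡ _ ⟨
      0# + g * z   ≈⟨ +-congʳ (trans a≈k ι-0) ⟨
      a + g * z    ≈⟨ y≈ ⟨
      _            ≈⟨ y≈gᵈ⁺¹ ⟩
      g * g ^ d    ∎))
    ... | no k≢0 = (g ^ d - z) * ι (ℚ.1/ k) ,
      ℚ[g].*∈ (ℚ[g].∸∈ (suc d , Overℚ.low-^ (ℕ.n<1+n d)) (d , Lz)) (1 , Overℚ.low-const 0 (ℚ.1/ k , refl)) , (begin
      g * ((g ^ d - z) * ι (ℚ.1/ k))
        ≈⟨ solve 4 (λ g gᵈ z k → g :* ((gᵈ :- z) :* k) :=
             (g :* gᵈ :- g :* z) :* k) refl g (g ^ d) z (ι (ℚ.1/ k)) ⟩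
      (g * g ^ d - g * z) * ι (ℚ.1/ k)        ≈⟨ *-congʳ (+-congʳ (trans (sym y≈gᵈ⁺¹) y≈)) ⟩
      (a + g * z - g * z) * ι (ℚ.1/ k)
        ≈⟨ *-congʳ (trans (solve 2 (λ a z → a :+ z :- z := a) refl a (g * z)) a≈k) ⟩
      ι k * ι (ℚ.1/ k)                        ≈⟨ ι-* k (ℚ.1/ k) ⟨
      ι (k ℚ.* ℚ.1/ k)                        ≈⟨ trans (ι-cong (ℚ.*-inverseʳ k)) ι-1 ⟩
      1#                                      ∎)
      where instance _ = ℚ.≢-nonZero k≢0

  polynomial⇒ℚ⟨⟩ : ∀ {θ x} → Polynomial ℚ∈ θ x → ℚ⟨ θ ⟩ x
  polynomial⇒ℚ⟨⟩ {θ} {x} (d , Lx) =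
    let f , x≈f = low⇒polynomial ι Lx in
    d , 1 , f , one , invertible⇒# (1# , inverse , trans (*-comm _ _) inverse) ,
    trans (*-congˡ one≈1) (trans (*-identityʳ x) x≈f)
    where
    one : Vector ℚ 1
    one _ = ℚ.1ℚ

    one≈1 : polynomial ι one θ ≈ 1#
    one≈1 = trans (+-identityʳ _) (trans (*-identityʳ _) ι-1)

    inverse : 1# * (polynomial ι one θ - 0#) ≈ 1#
    inverse = trans (*-identityˡ _) (trans (+-cong one≈1 -0#≈0#) (+-identityʳ _))

  -- A denominator g(θ) is itself algebraic, so its inverse is a polynomial in g(θ), hence in θ.
  ℚ⟨⟩⇒polynomial : ∀ {θ x} → Algebraic ℚ∈ θ → ℚ⟨ θ ⟩ x → Polynomial ℚ∈ θ x
  ℚ⟨⟩⇒polynomial {θ} {x} θ-alg (m , n , f , g , g#0 , xg≈f) =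
    let v , _ , gv≈1 = #⇒invertible g#0
        w , w∈ , gw≈1 = algebraic-inverse (trans (*-congʳ (sym g-0≈g)) gv≈1)
                          (polynomial⊆ Overℚ.algebraic-isSubring Overℚ.const⇒algebraic θ-alg ℚ[θ]g)
    in ℚ[θ].resp (begin
      F′ * w        ≈⟨ *-congʳ xg≈f ⟨
      x * G * w     ≈⟨ *-assoc _ _ _ ⟩
      x * (G * w)   ≈⟨ *-congˡ gw≈1 ⟩
      x * 1#        ≈⟨ *-identityʳ x ⟩
      x             ∎)
      (ℚ[θ].*∈ (m , polynomial⇒low ι f) (polynomial⊆ (Overℚ.polynomial-isSubring {θ}) const∈ ℚ[θ]g w∈))
    where
    module ℚ[θ] = IsSubring (Overℚ.polynomial-isSubring {θ})
    F′ = polynomial ι f θ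
    G = polynomial ι g θ

    const∈ : ∀ {a} → ℚ∈ a → Polynomial ℚ∈ θ a
    const∈ a∈ = 1 , Overℚ.low-const 0 a∈

    ℚ[θ]g : Polynomial ℚ∈ θ G
    ℚ[θ]g = n , polynomial⇒low ι g

    g-0≈g : G - 0# ≈ G
    g-0≈g = trans (+-congˡ -0#≈0#) (+-identityʳ G)

-- Passing from α to β, and the ring of integers of ℚ(α)

module RadicalField {c ℓ₁ ℓ₂} (F : ℚ-Field c ℓ₁ ℓ₂) where

  open FieldProperties F
  open Integrality F
  open Polynomials F
  open Rationals F

  -- `N` stands for the product of the q_i^(v_i) by which the theorem divides; it equals Q^V only
  -- propositionally, so it is a separate parameter.
  module Generator (n : ℕ) (p-prime : Prime (suc n))
    (Q : ℕ) {{Q≢0 : NonZero Q}} (Q-squarefree : ∀ {ℓ} → Prime ℓ → ℓ ℕ.∣ Q → ℓ Arithmetic.∥ Q)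
    {q₀ : ℕ} (q₀-prime : Prime q₀) (q₀∣Q : q₀ ℕ.∣ Q)
    (α : Carrier) (E u V N : ℕ) {{N≢0 : NonZero N}} (N≡ : N ≡ Q ℕ.^ V)
    (Eu≡ : E ℕ.* u ≡ 1 ℕ.+ suc n ℕ.* V) (α^p≈ : α ^ suc n ≈ ιℕ (Q ℕ.^ E))
    where

    private
      p : ℕ
      p = suc n

    β : Carrier
    β = (α ^ u) ÷ N

    Nβ≈ : ιℕ N * β ≈ α ^ u
    Nβ≈ = begin
      ιℕ N * (α ^ u * ι (1ℤ ℚ./ N))
        ≈⟨ solve 3 (λ N A M → N :* (A :* M) := A :* (N :* M)) refl (ιℕ N) (α ^ u) (ι (1ℤ ℚ./ N)) ⟩
      α ^ u * (ιℕ N * ι (1ℤ ℚ./ N))   ≈⟨ *-congˡ (ιℕ-inverse N) ⟩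
      α ^ u * 1#                      ≈⟨ *-identityʳ _ ⟩
      α ^ u                           ∎

    N^β^≈ : ∀ k → ιℕ (N ℕ.^ k) * β ^ k ≈ α ^ (u ℕ.* k)
    N^β^≈ k = begin
      ιℕ (N ℕ.^ k) * β ^ k     ≈⟨ *-congʳ (ιℕ-^ N k) ⟩
      ιℕ N ^ k * β ^ k         ≈⟨ ^-distrib-* (ιℕ N) β k ⟨
      (ιℕ N * β) ^ k           ≈⟨ ^-congˡ k Nβ≈ ⟩
      (α ^ u) ^ k              ≈⟨ ^-assocʳ α u k ⟩
      α ^ (u ℕ.* k)            ∎

    α^p*≈ : ∀ k → α ^ (p ℕ.* k) ≈ ιℕ (Q ℕ.^ (E ℕ.* k))
    α^p*≈ k = begin
      α ^ (p ℕ.* k)          ≈⟨ ^-assocʳ α p k ⟨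
      (α ^ p) ^ k            ≈⟨ ^-congˡ k α^p≈ ⟩
      ιℕ (Q ℕ.^ E) ^ k       ≈⟨ ιℕ-^ (Q ℕ.^ E) k ⟨
      ιℕ ((Q ℕ.^ E) ℕ.^ k)   ≈⟨ ιℤ-cong (≡.cong ℤ.+_ (ℕ.^-*-assoc Q E k)) ⟩
      ιℕ (Q ℕ.^ (E ℕ.* k))   ∎

    Q^V*≡ : ∀ k → Q ℕ.^ (V ℕ.* k) ≡ N ℕ.^ k
    Q^V*≡ k = ≡.trans (≡.sym (ℕ.^-*-assoc Q V k)) (≡.cong (ℕ._^ k) (≡.sym N≡))

    -- From N β = α^u: N^p β^p = α^(pu) = Q^(Eu) = Q · Q^(pV) = Q N^p.
    β^p≈Q : β ^ p ≈ ιℕ Q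
    β^p≈Q = ιℕ-cancel (N ℕ.^ p) {{ℕ.m^n≢0 N p}} (begin
      ιℕ (N ℕ.^ p) * β ^ p             ≈⟨ N^β^≈ p ⟩
      α ^ (u ℕ.* p)                    ≈⟨ ^-congʳ α (ℕ.*-comm u p) ⟩
      α ^ (p ℕ.* u)                    ≈⟨ α^p*≈ u ⟩
      ιℕ (Q ℕ.^ (E ℕ.* u))             ≈⟨ ιℤ-cong (≡.cong (λ k → + (Q ℕ.^ k)) Eu≡) ⟩
      ιℕ (Q ℕ.* Q ℕ.^ (p ℕ.* V))       ≈⟨ ιℕ-* Q (Q ℕ.^ (p ℕ.* V)) ⟩
      ιℕ Q * ιℕ (Q ℕ.^ (p ℕ.* V))
        ≈⟨ *-congˡ (ιℤ-cong (≡.cong ℤ.+_ (≡.trans (≡.cong (Q ℕ.^_) (ℕ.*-comm p V)) (Q^V*≡ p)))) ⟩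
      ιℕ Q * ιℕ (N ℕ.^ p)              ≈⟨ *-comm _ _ ⟩
      ιℕ (N ℕ.^ p) * ιℕ Q              ∎)

    -- The same relation to the power E: N^E β^E = α^(uE) = α · α^(pV) = α Q^(EV) = α N^E.
    β^E≈α : β ^ E ≈ α
    β^E≈α = ιℕ-cancel (N ℕ.^ E) {{ℕ.m^n≢0 N E}} (begin
      ιℕ (N ℕ.^ E) * β ^ E             ≈⟨ N^β^≈ E ⟩
      α ^ (u ℕ.* E)                    ≈⟨ ^-congʳ α (≡.trans (ℕ.*-comm u E) Eu≡) ⟩
      α * α ^ (p ℕ.* V)                ≈⟨ *-congˡ (α^p*≈ V) ⟩
      α * ιℕ (Q ℕ.^ (E ℕ.* V))
        ≈⟨ *-congˡ (ιℤ-cong (≡.cong ℤ.+_ (≡.trans (≡.cong (Q ℕ.^_) (ℕ.*-comm E V)) (Q^V*≡ E)))) ⟩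
      α * ιℕ (N ℕ.^ E)                 ≈⟨ *-comm _ _ ⟩
      ιℕ (N ℕ.^ E) * α                 ∎)

    open Radical.Root F n p-prime Q Q-squarefree q₀-prime q₀∣Q β β^p≈Q hiding (p)

    K : Pred Carrier _
    K = ℚ⟨ α ⟩

    ℚ[_] : Carrier → Pred Carrier _
    ℚ[ θ ] = Polynomial ℚ∈ θ

    module ℚ[α] = IsSubring (Overℚ.polynomial-isSubring {α})
    module ℚ[β] = IsSubring (Overℚ.polynomial-isSubring {β})

    generator∈ : ∀ θ → ℚ[ θ ] θ
    generator∈ θ = 2 , low-resp (*-identityʳ θ) (Overℚ.low-^ {i = 1} (ℕ.s<s ℕ.z<s))

    const∈ : ∀ {θ a} → ℚ∈ a → ℚ[ θ ] a
    const∈ a∈ = 1 , Overℚ.low-const 0 a∈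

    α∈ℚ[β] : ℚ[ β ] α
    α∈ℚ[β] = ℚ[β].resp β^E≈α (ℚ[β].^∈ E (generator∈ β))

    β∈ℚ[α] : ℚ[ α ] β
    β∈ℚ[α] = ℚ[α].*∈ (ℚ[α].^∈ u (generator∈ α)) (const∈ (1ℤ ℚ./ N , refl))

    α-algebraic : Algebraic ℚ∈ α
    α-algebraic = p , low-resp (sym α^p≈) (Overℚ.low-const n (fromℤ (+ (Q ℕ.^ E)) , refl))

    K⇒ℚ[α] : ∀ {x} → K x → ℚ[ α ] x
    K⇒ℚ[α] = ℚ⟨⟩⇒polynomial α-algebraic

    K⇒ℚ[β] : ∀ {x} → K x → ℚ[ β ] x
    K⇒ℚ[β] Kx = polynomial⊆ (Overℚ.polynomial-isSubring {β}) const∈ α∈ℚ[β] (K⇒ℚ[α] Kx)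

    ℚ[β]⇒K : ∀ {x} → ℚ[ β ] x → K x
    ℚ[β]⇒K x∈ = polynomial⇒ℚ⟨⟩ (polynomial⊆ (Overℚ.polynomial-isSubring {α}) const∈ β∈ℚ[α] x∈)

    R⇒K : ∀ {x} → R x → K x
    R⇒K Rx = ℚ[β]⇒K (polynomial⊆ (Overℚ.polynomial-isSubring {β}) (λ { (a , x≈) → const∈ (fromℤ a , x≈) }) (generator∈ β) Rx)

    -- A common denominator of the differences reduces this to independence over ℤ.
    independentℚ : ∀ (k l : Vector ℚ p) → polynomial ι k β ≈ polynomial ι l β → ∀ i → k i ≡ l i
    independentℚ k l k≈l i with common-denominator (λ i → k i ℚ.- l i)
    ... | D , D≢0 , z , Dh≈z = ℚ-ring.x-y≈0⇒x≈y (k i) (l i) (ι≈0⇒≡0 (h i) (ιℕ-cancel D (begin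
      ιℕ D * ι (h i)    ≈⟨ Dh≈z i ⟩
      ιℤ (z i)          ≈⟨ ιℤ-cong (independent z z≈0 i) ⟩
      ιℤ (+ 0)          ≈⟨ ιℤ-0 ⟩
      0#                ≈⟨ zeroʳ _ ⟨
      ιℕ D * 0#         ∎)))
      where
      module ℚ-ring where
        open import Algebra.Properties.Group ℚ.+-0-group public using () renaming (x∙y⁻¹≈ε⇒x≈y to x-y≈0⇒x≈y)

      instance _ = D≢0

      h : Vector ℚ p
      h i = k i ℚ.- l i

      h+l≡k : ∀ i → h i ℚ.+ l i ≡ k i
      h+l≡k i = ≡.trans (ℚ.+-assoc (k i) (ℚ.- l i) (l i))
                  (≡.trans (≡.cong (λ t → k i ℚ.+ t) (ℚ.+-inverseˡ (l i))) (ℚ.+-identityʳ (k i)))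

      h≈0 : polynomial ι h β ≈ 0#
      h≈0 = begin
        polynomial ι h β
          ≈⟨ solve 2 (λ h g → h := h :+ g :- g) refl (polynomial ι h β) (polynomial ι l β) ⟩
        polynomial ι h β + polynomial ι l β - polynomial ι l β
          ≈⟨ +-congʳ (polynomial-+ ι ι-+ ι-* h l β) ⟨
        polynomial ι (λ i → h i ℚ.+ l i) β - polynomial ι l β
          ≈⟨ +-congʳ (trans (polynomial-cong ι (λ i → ι-cong (h+l≡k i)) β) k≈l) ⟩
        polynomial ι l β - polynomial ι l β                       ≈⟨ -‿inverseʳ _ ⟩
        0#                                                        ∎

      z≈0 : ⟦ z ⟧ ≈ 0#
      z≈0 = begin
        ⟦ z ⟧
          ≈⟨ polynomial-cong id (λ i → sym (Dh≈z i)) β ⟩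
        polynomial id (λ i → ιℕ D * ι (h i)) β
          ≈⟨ polynomial-scale id (λ _ _ → refl) (λ _ _ → refl) (ιℕ D) (ι ∘ h) β ⟩
        ιℕ D * polynomial ι h β                              ≈⟨ trans (*-congˡ h≈0) (zeroʳ _) ⟩
        0#                                                   ∎

    degree : HasDegree K p
    degree = powers β p ,
      (λ i → ℚ[β]⇒K (ℚ[β].^∈ (toℕ i) (generator∈ β))) ,
      (λ x Kx → low⇒polynomial ι (Overℚ.reduce (low-resp (sym β^p≈Q) (Overℚ.low-const n (fromℤ (+ Q) , refl))) (K⇒ℚ[β] Kx))) ,
      independentℚ

    K-+ : ∀ {x y} → K x → K y → K (x + y)
    K-+ Kx Ky = ℚ[β]⇒K (ℚ[β].+∈ (K⇒ℚ[β] Kx) (K⇒ℚ[β] Ky))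

    K-neg : ∀ {x} → K x → K (- x)
    K-neg Kx = ℚ[β]⇒K (ℚ[β].-∈ (K⇒ℚ[β] Kx))

    R⇒𝒪 : ∀ {x} → R x → 𝒪 K x
    R⇒𝒪 Rx = R⇒K Rx , algebraic⇒integral (R⊆Int Rx)

    ℤ[]⇒polynomial : ∀ {θ x} → ℤ[ θ ] x → Polynomial ℤ∈ θ x
    ℤ[]⇒polynomial (d , f , x≈) = d , low-resp (sym x≈) (polynomial⇒low ιℤ f)

    polynomial⇒ℤ[] : ∀ {θ x} → Polynomial ℤ∈ θ x → ℤ[ θ ] x
    polynomial⇒ℤ[] (d , Lx) = d , low⇒polynomial ιℤ Lx

    factors≢p : ∀ ℓs → ¬ p ℕ.∣ product ℓs → All (_≢ p) ℓs
    factors≢p []       p∤ = []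
    factors≢p (ℓ ∷ ℓs) p∤ =
      (λ { ≡.refl → p∤ (ℕ.m∣m*n (product ℓs)) }) ∷ factors≢p ℓs (λ p∣ → p∤ (ℕ.∣n⇒∣m*n ℓ p∣))

    -- With m the index of ℤ[α], the element m x lies in ℤ[α] ⊆ ℤ[β]. As p does not divide m,
    -- maximality at each prime factor of m cancels that factor.
    𝒪⇒R : Maximal p K ℤ[ α ] → ∀ {x} → 𝒪 K x → R x
    𝒪⇒R (m , index , p∤m) {x} 𝒪x@(_ , x-int) =
      maximal factors factorsPrime (factors≢p factors (≡.subst (λ m → ¬ p ℕ.∣ m) isFactorisation p∤m))
        (integral⇒algebraic x-int) (≡.subst (λ m → R (ιℕ m * x)) isFactorisation (ℤ[α]⊆R (index*∈ index 𝒪x)))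
      where
      -- An index 0 would be divisible by p; this is what allows the factorisation of m.
      m≢0 : m ≢ 0
      m≢0 ≡.refl = p∤m (p ℕ.∣0)

      open PrimeFactorisation (factorise m {{ℕ.≢-nonZero m≢0}})

      ℤ[α]⊆R : ∀ {y} → ℤ[ α ] y → R y
      ℤ[α]⊆R y∈ = polynomial⊆ (Overℤ.polynomial-isSubring {β}) (λ { (a , y≈) → R.resp (sym y≈) (const∈R a) })
                    (R.resp β^E≈α (R.^∈ E β∈R)) (ℤ[]⇒polynomial y∈)

      module ℤ[α] = IsSubring (Overℤ.polynomial-isSubring {α})

      open Lagrange.Cosets F {G = 𝒪 K} {H = ℤ[ α ]}
        (λ (Kx , x-int) (Ky , y-int) → K-+ Kx Ky ,
           algebraic⇒integral (Int.+∈ (integral⇒algebraic x-int) (integral⇒algebraic y-int)))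
        (λ (Kx , x-int) → K-neg Kx , algebraic⇒integral (Int.-∈ (integral⇒algebraic x-int)))
        (λ x≈y x∈ → polynomial⇒ℤ[] (ℤ[α].resp x≈y (ℤ[]⇒polynomial x∈)))
        (polynomial⇒ℤ[] ℤ[α].0∈)
        (λ x∈ y∈ → polynomial⇒ℤ[] (ℤ[α].+∈ (ℤ[]⇒polynomial x∈) (ℤ[]⇒polynomial y∈)))

    monogenic : Maximal p K ℤ[ α ] → Monogenic K × 𝒪 K ≐ ℤ[ β ]
    monogenic ℤ[α]-maximal =
      (p , degree , β , R⇒𝒪 β∈R ,
        (λ i → R⇒𝒪 (R.^∈ (toℕ i) β∈R)) , (λ x 𝒪x → coordinates (𝒪⇒R ℤ[α]-maximal 𝒪x)) , coordinates-unique) ,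
      (λ 𝒪x → polynomial⇒ℤ[] (𝒪⇒R ℤ[α]-maximal 𝒪x)) , (λ x∈ → R⇒𝒪 (ℤ[]⇒polynomial x∈))

-- Congruent exponents are equal, and so are the Bézout data

module Exponents {n k} (p-prime : Prime (suc n)) (e u v : Vector ℕ (suc k))
  (e-bounds : ∀ i → 1 ℕ.≤ e i × e i ℕ.≤ n)
  (u-bounds : ∀ i → 1 ℕ.≤ u i × u i ℕ.≤ n)
  (eu≡1+pv : ∀ i → e i ℕ.* u i ≡ 1 ℕ.+ suc n ℕ.* v i)
  (e-congruent : ∀ i j → ¬ suc n ℕ.∣ e i → ¬ suc n ℕ.∣ e j → suc n ℕ.∣ ℕ.∣ e i - e j ∣)
  where

  open Arithmetic

  p : ℕ
  p = suc n

  p∤e : ∀ i → ¬ p ℕ.∣ e i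
  p∤e i = ℕ.>⇒∤ {{ℕ.>-nonZero (proj₁ (e-bounds i))}} (ℕ.s≤s (proj₂ (e-bounds i)))

  e-constant : ∀ i → e i ≡ e zero
  e-constant i = ∣diff∣<⇒≡ (ℕ.s≤s (proj₂ (e-bounds i))) (ℕ.s≤s (proj₂ (e-bounds zero)))
    (e-congruent i zero (p∤e i) (p∤e zero))

  -- With equal exponents e, both e u_i and e u_0 are 1 modulo p, so p divides e (u_i - u_0) but not
  -- e.
  u-constant : ∀ i → u i ≡ u zero
  u-constant i = ∣diff∣<⇒≡ (ℕ.s≤s (proj₂ (u-bounds i))) (ℕ.s≤s (proj₂ (u-bounds zero)))
    ([ (λ p∣e₀ → contradiction p∣e₀ (p∤e zero)) , id ]′ (euclidsLemma (e zero) _ p-prime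
      (≡.subst (p ℕ.∣_) (≡.sym (ℕ.*-distribˡ-∣-∣ (e zero) (u i) (u zero)))
        (∣difference p (≡.trans (≡.cong (ℕ._* u i) (≡.sym (e-constant i))) (eu≡1+pv i)) (eu≡1+pv zero)))))

  v-constant : ∀ i → v i ≡ v zero
  v-constant i = ℕ.*-cancelˡ-≡ (v i) (v zero) p (ℕ.suc-injective
    (≡.trans (≡.sym (eu≡1+pv i)) (≡.trans (≡.cong₂ ℕ._*_ (e-constant i) (u-constant i)) (eu≡1+pv zero))))

open import Data.Nat.Base using (_+_; _*_; _∸_; _^_; _≤_; ∣_-_∣)
open import Data.Nat.Divisibility using (_∣_)

proposition6p4 : ∀ {c ℓ₁ ℓ₂} (F : ℚ-Field c ℓ₁ ℓ₂) →
    let module N = NumberFields F in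
    ∀ (p : ℕ) → Prime p → ¬ (2 ∣ p) →
    ∀ {k} (q e : Vector ℕ (suc k)) →
    (q-prime : ∀ i → Prime (q i)) → Injective _≡_ _≡_ q →
    (∀ i → 1 ≤ e i × e i ≤ p ∸ 1) →
    ∀ (a : ℕ) → a ≡ ∏ (λ i → q i ^ e i) →
    ∀ (α : N.Carrier) → (α N.^ p) N.≈ N.ιℕ a →
    ∀ (u v : Vector ℕ (suc k)) →
    (∀ i → 1 ≤ u i × u i ≤ p ∸ 1) →
    (∀ i → e i * u i ≡ 1 + p * v i) →
    N.Maximal p N.ℚ⟨ α ⟩ N.ℤ[ α ] →
    (∀ i j → ¬ (p ∣ e i) → ¬ (p ∣ e j) → p ∣ ∣ e i - e j ∣) →
    N.Monogenic N.ℚ⟨ α ⟩ ×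
    N.𝒪 N.ℚ⟨ α ⟩ ≐ N.ℤ[ N._÷_ (α N.^ u zero) (∏ (λ i → q i ^ v i)) {{∏-prime-powers≢0 q-prime v}} ]
proposition6p4 F zero 0-prime = contradiction 0-prime ¬prime[0]
proposition6p4 F (suc n) p-prime _ q e q-prime q-injective e-bounds a a≡ α αᵖ≈a u v u-bounds eu≡1+pv
               ℤ[α]-maximal e-congruent =
  -- As m ≥ 1, the entry `q zero` exists and serves as the prime factor of Q. The exponents E, u and
  -- V can be read off at index `zero` because they are constant.
  RadicalField.Generator.monogenic F n p-prime Q {{Q≢0}} squarefree (q-prime zero) (ℕ.m∣m*n (∏ (q ∘ suc)))
    α (e zero) (u zero) (v zero) (∏ (λ i → q i ^ v i)) {{∏-prime-powers≢0 q-prime v}} ∏qᵛ≡Qⱽ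
    (eu≡1+pv zero) (trans αᵖ≈a (ιℤ-cong (≡.cong ℤ.+_ a≡Qᴱ))) ℤ[α]-maximal
  where
  open FieldProperties F using (trans; ιℤ-cong)
  open Arithmetic using (∏-cong; ∏-^; prime∣∏; prime∥∏; _∥_)
  open Exponents p-prime e u v e-bounds u-bounds eu≡1+pv e-congruent using (e-constant; v-constant)

  Q : ℕ
  Q = ∏ q

  ∏qᵛ≡Qⱽ : ∏ (λ i → q i ^ v i) ≡ Q ^ v zero
  ∏qᵛ≡Qⱽ = ≡.trans (∏-cong (λ i → ≡.cong (q i ^_) (v-constant i))) (∏-^ q (v zero))

  a≡Qᴱ : a ≡ Q ^ e zero
  a≡Qᴱ = ≡.trans a≡ (≡.trans (∏-cong (λ i → ≡.cong (q i ^_) (e-constant i))) (∏-^ q (e zero)))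

  Q≢0 : NonZero Q
  Q≢0 = ≡.subst NonZero (∏-cong (λ i → ℕ.^-identityʳ (q i))) (∏-prime-powers≢0 q-prime (λ _ → 1))

  squarefree : ∀ {ℓ} → Prime ℓ → ℓ ∣ Q → ℓ ∥ Q
  squarefree ℓ-prime ℓ∣Q with prime∣∏ ℓ-prime q-prime ℓ∣Q
  ... | i , ≡.refl = prime∥∏ q-prime q-injective i
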